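{- For every positive integer $b$, Angel wins the fractional $b$-Devil game on the wedge digraph $W^{24b}$, and hence Angel also wins the $b$-biased Angel-Devil game on $W^{24b}$.
   Context: $W^n$ is the digraph whose vertices are nonnegative integer $n$-tuples, with an edge $x\to y$ iff $y$ is obtained from $x$ by increasing one coordinate by $1$, rooted at the zero tuple. The fractional $p$-Devil game on a rooted digraph: each vertex has a damage in $[0,1]$, initially $0$; Angel starts at the root; players alternate, Angel first; Angel moves to an out-neighbor of his current vertex whose damage is less than $1$; Devil on his turn increases damages on a finite set of vertices by total amount at most $p$. The $b$-biased Angel-Devil game is the same except vertices are burned or unburned, Angel may only move to unburned vertices, and Devil burns at most $b$ vertices per turn. In both, Devil wins if Angel is ever unable to move; Angel wins if he can move forever.
   Formalization: In the fractional game the amounts by which Devil increases damages are rational numbers rather than arbitrary reals; the statement about the b-biased game is unrestricted. -}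

module Defs where

open import Data.Nat as ℕ using (ℕ; zero; suc; _*_)
open import Data.Fin using (Fin)
open import Data.Vec using (Vec; replicate; updateAt)
open import Data.Vec.Properties using (≡-dec)
open import Data.List using (List; []; _∷_; length; map; concat)
open import Data.List.Relation.Unary.All using (All)
open import Data.List.Membership.Propositional using (_∈_)
open import Data.Product using (_×_; _,_; proj₁; proj₂; Σ; ∃)
open import Data.Integer using (+_)
open import Data.Rational using (ℚ; 0ℚ; 1ℚ; _+_; _≤_; _<_; _/_)
open import Relation.Nullary using (¬_; yes; no)

-- The wedge digraph W^n
-- Vertices: n-tuples of naturals.  Edges x → y iff y is x with one
-- coordinate increased by 1; so an out-neighbour of x is determined by a
-- coordinate i : Fin n.  Root: the zero tuple.

Vertex : ℕ → Set
Vertex n = Vec ℕ n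

root : ∀ {n} → Vertex n
root = replicate _ 0

step : ∀ {n} → Vertex n → Fin n → Vertex n
step x i = updateAt x i suc

-- Common play skeleton.
-- Angel's strategy sees the full history of Devil's moves (newest first)
-- and names the out-neighbour (coordinate) to move to.
-- Devil's strategy sees the full history of Angel's positions
-- (newest first, ending with the root).

AngelStrategy : ℕ → Set → Set
AngelStrategy n M = List M → Fin n

DevilStrategy : ℕ → Set → Set
DevilStrategy n M = List (Vertex n) → M

play : ∀ {n} {M : Set} → AngelStrategy n M → DevilStrategy n M →
       ℕ → List (Vertex n) × List M
play σ τ zero = (root ∷ [] , [])
play {n} {M} σ τ (suc k) = next (play σ τ k)
  where
  current : List (Vertex n) → Vertex n
  current []      = root
  current (x ∷ _) = x
  next : List (Vertex n) × List M → List (Vertex n) × List M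
  next (ps , ds) =
    let ps′ = step (current ps) (σ ds) ∷ ps
    in (ps′ , τ ps′ ∷ ds)

-- Angel's target vertex in round k (0-based), and the Devil moves made
-- before it (these determine which vertices are damaged/burned at that time).
angelTarget : ∀ {n} {M : Set} → AngelStrategy n M → DevilStrategy n M → ℕ → Vertex n
angelTarget σ τ k with play σ τ k
... | ([] , ds)    = step root (σ ds)
... | (x ∷ _ , ds) = step x (σ ds)

devilHistory : ∀ {n} {M : Set} → AngelStrategy n M → DevilStrategy n M → ℕ → List M
devilHistory σ τ k = proj₂ (play σ τ k)

sumℚ : List ℚ → ℚ
sumℚ []       = 0ℚ
sumℚ (a ∷ as) = a + sumℚ as

record FracMove (n : ℕ) (p : ℚ) : Set where
  constructor fracMove
  field
    increments : List (Vertex n × ℚ)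
    nonneg     : All (λ e → 0ℚ ≤ proj₂ e) increments
    budget     : sumℚ (map proj₂ increments) ≤ p

moveDamage : ∀ {n p} → FracMove n p → Vertex n → ℚ
moveDamage m v = go (FracMove.increments m)
  where
  go : List (Vertex _ × ℚ) → ℚ
  go []             = 0ℚ
  go ((w , a) ∷ es) with ≡-dec ℕ._≟_ w v
  ... | yes _ = a + go es
  ... | no  _ = go es

damage : ∀ {n p} → List (FracMove n p) → Vertex n → ℚ
damage []       v = 0ℚ
damage (m ∷ ms) v = moveDamage m v + damage ms v

AngelWinsFrac : ℕ → ℚ → Set
AngelWinsFrac n p =
  Σ (AngelStrategy n (FracMove n p)) λ σ →
    (τ : DevilStrategy n (FracMove n p)) → (k : ℕ) →
      damage (devilHistory σ τ k) (angelTarget σ τ k) < 1ℚ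

record BurnMove (n : ℕ) (b : ℕ) : Set where
  constructor burnMove
  field
    burned : List (Vertex n)
    bound  : length burned ℕ.≤ b

burnedSoFar : ∀ {n b} → List (BurnMove n b) → List (Vertex n)
burnedSoFar ms = concat (map BurnMove.burned ms)

AngelWinsBiased : ℕ → ℕ → Set
AngelWinsBiased n b =
  Σ (AngelStrategy n (BurnMove n b)) λ σ →
    (τ : DevilStrategy n (BurnMove n b)) → (k : ℕ) →
      ¬ (angelTarget σ τ k ∈ burnedSoFar (devilHistory σ τ k))

ℕtoℚ : ℕ → ℚ
ℕtoℚ b = (+ b) / 1

{-# OPTIONS --safe #-}
-- Split the 24b coordinates into three groups of 8b.  Angel fixes only the groups of his next 16 to 20 moves (the plan);
-- within the group he takes the coordinate minimising a potential, the expected damage met by a uniformly random walk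
-- along the plan, the j-th vertex of which gets the weight (4/3)^j.  On average a move multiplies the potential by 3/4,
-- Devil adds at most 1/6, and a vertex entering at the far end is hit with tiny probability.  Hence it is enough that the
-- damage of all vertices with the planned group counts is at most 3576 times Devil's power when they enter the plan.
--
-- That is a fractional game on the group counts, with power P and tolerance 3576 P, and it is won by a self-similar
-- strategy.  A coarse vertex Z owns 120² starting points, indexed by offsets; a move of the coarse play is realised by a
-- block of 596 moves from one starting point to another, and the damage of Z is the total damage on all such paths from Z.
-- Given the coarse letter and one of the two offsets, a vertex determines the rest of the path through it, so the coarse
-- Devil has power at most 3 · 120² · 596 P per block, and the same strategy, applied to the coarse game, controls the
-- damage of the coarse vertices.  Averaging over the offset at the end of a block then keeps both the path of the
-- block and the fan of its continuations cheap.  The recursion ends because a game of k moves has k / 596 coarse ones.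
module Submission where

open import Defs
open import Algebra.Bundles using (CommutativeMonoid)
import Algebra.Properties.CommutativeMonoid.Mult as CMult
open import Data.Empty using (⊥; ⊥-elim)
open import Data.Fin as Fin using (Fin; toℕ; combine; remQuot)
open import Data.Fin.Patterns using (0F; 1F; 2F; 3F; 4F)
import Data.Fin.Properties as FinP
import Data.Integer as ℤ
import Data.Integer.Properties as ℤP
open import Data.List using (List; []; _∷_; _++_; length; map; concatMap; replicate; take; drop; cartesianProduct; allFin)
import Data.List.Properties as ListP
open import Data.List.Membership.Propositional using (_∈_)
open import Data.List.Membership.Propositional.Properties using (∈-++⁻; ∈-++⁺ʳ; ∈-map⁻)
open import Data.List.Relation.Unary.All as All using (All; []; _∷_)
import Data.List.Relation.Unary.All.Properties as AllP
open import Data.List.Relation.Unary.AllPairs using ([]; _∷_)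
open import Data.List.Relation.Unary.Any using (here; there)
open import Data.List.Relation.Unary.Unique.Propositional using (Unique)
import Data.List.Relation.Unary.Unique.Propositional.Properties as UniqueP
open import Data.Nat as ℕ using (ℕ; zero; suc; _+_; _*_; _∸_; _^_; _!; _≤_; _<_; _>_; z≤n; s≤s)
open import Data.Nat.Properties as ℕP hiding (_≟_)
open import Data.Nat.Tactic.RingSolver using (solve-∀)
open import Data.Product using (_×_; _,_; proj₁; proj₂; ∃)
open import Data.Product.Properties using (,-injective) renaming (≡-dec to ×-≡-dec)
open import Data.Rational as ℚ using (ℚ; 0ℚ; 1ℚ)
import Data.Rational.Properties as ℚP
import Data.Rational.Unnormalised as ℚᵘ
import Data.Rational.Unnormalised.Properties as ℚᵘP
open import Data.Sum using (_⊎_; inj₁; inj₂)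
open import Data.Vec using (lookup)
import Data.Vec.Properties as VecP
open import Function using (_∘_)
open import Level using (0ℓ)
open import Relation.Binary.Definitions using (DecidableEquality; tri<; tri≈; tri>)
open import Relation.Binary.PropositionalEquality
open import Relation.Nullary using (¬_; Dec; yes; no)
open import Relation.Nullary.Decidable using (toWitness)

-- Sums, averages and multiplicities

module Summation (M : CommutativeMonoid 0ℓ 0ℓ) where
  open CommutativeMonoid M renaming (Carrier to C; _∙_ to _⊕_; trans to ≈-trans; sym to ≈-sym; refl to ≈-refl)
  open import Algebra.Properties.CommutativeSemigroup commutativeSemigroup using (interchange)

  ∑ : {A : Set} → (A → C) → List A → C
  ∑ f []       = ε
  ∑ f (x ∷ xs) = f x ⊕ ∑ f xs

  ∑-cong : {A : Set} {f g : A → C} (xs : List A) → (∀ x → f x ≈ g x) → ∑ f xs ≈ ∑ g xs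
  ∑-cong []       e = ≈-refl
  ∑-cong (x ∷ xs) e = ∙-cong (e x) (∑-cong xs e)

  ∑-++ : {A : Set} (f : A → C) (xs ys : List A) → ∑ f (xs ++ ys) ≈ ∑ f xs ⊕ ∑ f ys
  ∑-++ f []       ys = ≈-sym (identityˡ _)
  ∑-++ f (x ∷ xs) ys = ≈-trans (∙-congˡ (∑-++ f xs ys)) (≈-sym (assoc _ _ _))

  ∑-concatMap : {A B : Set} (f : B → C) (g : A → List B) (xs : List A) →
                ∑ f (concatMap g xs) ≈ ∑ (λ x → ∑ f (g x)) xs
  ∑-concatMap f g []       = ≈-refl
  ∑-concatMap f g (x ∷ xs) = ≈-trans (∑-++ f (g x) _) (∙-congˡ (∑-concatMap f g xs))

  ∑-⊕ : {A : Set} (f g : A → C) (xs : List A) → ∑ (λ x → f x ⊕ g x) xs ≈ ∑ f xs ⊕ ∑ g xs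
  ∑-⊕ f g []       = ≈-sym (identityˡ _)
  ∑-⊕ f g (x ∷ xs) = ≈-trans (∙-congˡ (∑-⊕ f g xs)) (interchange _ _ _ _)

  ∑-ε : {A : Set} (xs : List A) → ∑ (λ _ → ε) xs ≈ ε
  ∑-ε []       = ≈-refl
  ∑-ε (x ∷ xs) = ≈-trans (identityˡ _) (∑-ε xs)

  ∑-swap : {A B : Set} (f : A → B → C) (xs : List A) (ys : List B) →
           ∑ (λ x → ∑ (f x) ys) xs ≈ ∑ (λ y → ∑ (λ x → f x y) xs) ys
  ∑-swap f []       ys = ≈-sym (∑-ε ys)
  ∑-swap f (x ∷ xs) ys = ≈-trans (∙-congˡ (∑-swap f xs ys)) (≈-sym (∑-⊕ (f x) _ ys))

open Summation ℕP.+-0-commutativeMonoid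
module S = Summation ℚP.+-0-commutativeMonoid

S : {A : Set} → (A → ℚ) → List A → ℚ
S = S.∑

-- Natural multiples `n · x` replace quotients of rationals: each average is multiplied out by its
-- number of terms, and `·-cancel` divides at the end.
open CMult ℚP.+-0-commutativeMonoid using () renaming (_×_ to infixr 8 _·_)
open CMult ℚP.+-0-commutativeMonoid using (×-homo-+; ×-assocˡ; ×-distrib-+; ×-homo-1)

·-mono : ∀ n {x y} → x ℚ.≤ y → n · x ℚ.≤ n · y
·-mono zero    x≤y = ℚP.≤-refl
·-mono (suc n) x≤y = ℚP.+-mono-≤ x≤y (·-mono n x≤y)

·-nonneg : ∀ n {x} → 0ℚ ℚ.≤ x → 0ℚ ℚ.≤ n · x
·-nonneg zero    0≤x = ℚP.≤-refl
·-nonneg (suc n) 0≤x = ℚP.+-mono-≤ 0≤x (·-nonneg n 0≤x)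

·-monoˡ : ∀ {m n x} → 0ℚ ℚ.≤ x → m ≤ n → m · x ℚ.≤ n · x
·-monoˡ {n = n} 0≤x z≤n   = ·-nonneg n 0≤x
·-monoˡ {x = x} 0≤x (s≤s m≤n) = ℚP.+-monoʳ-≤ x (·-monoˡ 0≤x m≤n)

·-cancel : ∀ n {x y} → 0 < n → n · x ℚ.≤ n · y → x ℚ.≤ y
·-cancel (suc n) {x} {y} _ nx≤ny = ℚP.≮⇒≥ λ y<x →
  ℚP.<-irrefl refl (ℚP.<-≤-trans (ℚP.+-mono-<-≤ y<x (·-mono n (ℚP.<⇒≤ y<x))) nx≤ny)

S-mono : {A : Set} {f g : A → ℚ} (xs : List A) → (∀ x → f x ℚ.≤ g x) → S f xs ℚ.≤ S g xs
S-mono []       h = ℚP.≤-refl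
S-mono (x ∷ xs) h = ℚP.+-mono-≤ (h x) (S-mono xs h)

S-nonneg : {A : Set} {f : A → ℚ} (xs : List A) → (∀ x → 0ℚ ℚ.≤ f x) → 0ℚ ℚ.≤ S f xs
S-nonneg []       h = ℚP.≤-refl
S-nonneg (x ∷ xs) h = ℚP.+-mono-≤ (h x) (S-nonneg xs h)

S-· : {A : Set} (n : ℕ) (f : A → ℚ) (xs : List A) → S (λ x → n · f x) xs ≡ n · S f xs
S-· n f []       = sym (·-zero n)
  where
  ·-zero : ∀ n → n · 0ℚ ≡ 0ℚ
  ·-zero zero    = refl
  ·-zero (suc n) = trans (ℚP.+-identityˡ _) (·-zero n)
S-· n f (x ∷ xs) = trans (cong (n · f x ℚ.+_) (S-· n f xs)) (sym (×-distrib-+ (f x) _ n))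

x≤x+y : ∀ {x y} → 0ℚ ℚ.≤ y → x ℚ.≤ x ℚ.+ y
x≤x+y {x} 0≤y = ℚP.≤-trans (ℚP.≤-reflexive (sym (ℚP.+-identityʳ x))) (ℚP.+-monoʳ-≤ x 0≤y)

y≤x+y : ∀ {x y} → 0ℚ ℚ.≤ x → y ℚ.≤ x ℚ.+ y
y≤x+y {x} {y} 0≤x = ℚP.≤-trans (x≤x+y 0≤x) (ℚP.≤-reflexive (ℚP.+-comm y x))

∈⇒≤S : {A : Set} {f : A → ℚ} {x : A} {xs : List A} → (∀ x → 0ℚ ℚ.≤ f x) → x ∈ xs → f x ℚ.≤ S f xs
∈⇒≤S {xs = _ ∷ xs} h (here refl) = x≤x+y (S-nonneg xs h)
∈⇒≤S {xs = y ∷ _}  h (there x∈)  = ℚP.≤-trans (∈⇒≤S h x∈) (y≤x+y (h y))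

lesser : {A : Set} → (A → ℚ) → A → A → A
lesser f x y with f x ℚ.≤? f y
... | yes _ = x
... | no  _ = y

-- The first argument of type A is returned for the empty list only.
argmin : {A : Set} → (A → ℚ) → A → List A → A
argmin f d []           = d
argmin f d (x ∷ [])     = x
argmin f d (x ∷ y ∷ ys) = lesser f x (argmin f d (y ∷ ys))

lesser-∈ : {A : Set} (f : A → ℚ) {x y : A} {ys : List A} → y ∈ ys → lesser f x y ∈ x ∷ ys
lesser-∈ f {x} {y} y∈ with f x ℚ.≤? f y
... | yes _ = here refl
... | no  _ = there y∈

argmin-∈ : {A : Set} (f : A → ℚ) (d : A) (xs : List A) → 0 < length xs → argmin f d xs ∈ xs
argmin-∈ f d (x ∷ [])     _ = here refl
argmin-∈ f d (x ∷ y ∷ ys) _ = lesser-∈ f (argmin-∈ f d (y ∷ ys) (s≤s z≤n))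

lesser-minˡ : {A : Set} (f : A → ℚ) (x y : A) → f (lesser f x y) ℚ.≤ f x
lesser-minˡ f x y with f x ℚ.≤? f y
... | yes _ = ℚP.≤-refl
... | no ¬p = ℚP.<⇒≤ (ℚP.≰⇒> ¬p)

lesser-minʳ : {A : Set} (f : A → ℚ) (x y : A) → f (lesser f x y) ℚ.≤ f y
lesser-minʳ f x y with f x ℚ.≤? f y
... | yes p = p
... | no  _ = ℚP.≤-refl

argmin-min : {A : Set} (f : A → ℚ) (d : A) {z : A} (xs : List A) → z ∈ xs → f (argmin f d xs) ℚ.≤ f z
argmin-min f d (x ∷ [])     (here refl) = ℚP.≤-refl
argmin-min f d (x ∷ y ∷ ys) (here refl) = lesser-minˡ f x _
argmin-min f d (x ∷ y ∷ ys) (there z∈)  =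
  ℚP.≤-trans (lesser-minʳ f x (argmin f d (y ∷ ys))) (argmin-min f d (y ∷ ys) z∈)

length·≤S : {A : Set} {f : A → ℚ} {c : ℚ} (xs : List A) → (∀ {x} → x ∈ xs → c ℚ.≤ f x) → length xs · c ℚ.≤ S f xs
length·≤S []       h = ℚP.≤-refl
length·≤S (x ∷ xs) h = ℚP.+-mono-≤ (h (here refl)) (length·≤S xs (h ∘ there))

argmin-average : {A : Set} (f : A → ℚ) (d : A) (xs : List A) → length xs · f (argmin f d xs) ℚ.≤ S f xs
argmin-average f d xs = length·≤S xs (argmin-min f d xs)

∑-mono : {A : Set} {f g : A → ℕ} (xs : List A) → (∀ x → f x ≤ g x) → ∑ f xs ≤ ∑ g xs
∑-mono []       h = z≤n
∑-mono (x ∷ xs) h = +-mono-≤ (h x) (∑-mono xs h)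

∑-≤-length : {A : Set} {f : A → ℕ} {c : ℕ} (xs : List A) → (∀ x → f x ≤ c) → ∑ f xs ≤ length xs * c
∑-≤-length []       h = z≤n
∑-≤-length (x ∷ xs) h = +-mono-≤ (h x) (∑-≤-length xs h)

0<∑⇒∃ : {A : Set} (f : A → ℕ) (xs : List A) → 0 < ∑ f xs → ∃ λ x → x ∈ xs × 0 < f x
0<∑⇒∃ f (x ∷ xs) h with f x in e
... | suc k = x , here refl , subst (0 <_) (sym e) (s≤s z≤n)
... | zero  = let y , y∈ , p = 0<∑⇒∃ f xs h in y , there y∈ , p

≡0-or-0< : ∀ n → n ≡ 0 ⊎ 0 < n
≡0-or-0< zero    = inj₁ refl
≡0-or-0< (suc n) = inj₂ (s≤s z≤n)

𝟙 : {P : Set} → Dec P → ℕ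
𝟙 (yes _) = 1
𝟙 (no _)  = 0

𝟙≤1 : {P : Set} (d : Dec P) → 𝟙 d ≤ 1
𝟙≤1 (yes _) = ≤-refl
𝟙≤1 (no _)  = z≤n

0<𝟙⇒ : {P : Set} {d : Dec P} → 0 < 𝟙 d → P
0<𝟙⇒ {d = yes p} _ = p

𝟙-yes : {P : Set} (d : Dec P) → P → 𝟙 d ≡ 1
𝟙-yes (yes _) _ = refl
𝟙-yes (no ¬p) p = ⊥-elim (¬p p)

module Occurrences {A : Set} (_≟_ : DecidableEquality A) where

  occ : A → List A → ℕ
  occ v = ∑ (λ u → 𝟙 (v ≟ u))

  0<occ⇒∈ : ∀ {v} xs → 0 < occ v xs → v ∈ xs
  0<occ⇒∈ xs h with u , u∈ , p ← 0<∑⇒∃ _ xs h = subst (_∈ xs) (sym (0<𝟙⇒ p)) u∈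

  -- Positive values of `g` occur at no more than one point `x₀`, so `g` lies below the indicator of
  -- `x₀`, whose sum is the multiplicity of `x₀` in the list.
  ∑-unique : ∀ {n} (g : A → ℕ) (xs : List A) → (∀ x → g x ≤ 1) → (∀ {x y} → 0 < g x → 0 < g y → x ≡ y) →
             (∀ x → occ x xs ≤ n) → ∑ g xs ≤ n
  ∑-unique {n} g xs g≤1 uniq bound with ≡0-or-0< (∑ g xs)
  ... | inj₁ e = subst (_≤ n) (sym e) z≤n
  ... | inj₂ p with x₀ , _ , q ← 0<∑⇒∃ g xs p = ≤-trans (∑-mono xs pointwise) (bound x₀)
    where
    pointwise : ∀ x → g x ≤ 𝟙 (x₀ ≟ x)
    pointwise x with ≡0-or-0< (g x)
    ... | inj₁ e = subst (_≤ _) (sym e) z≤n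
    ... | inj₂ r = subst (g x ≤_) (sym (𝟙-yes (x₀ ≟ x) (uniq q r))) (g≤1 x)

  -- The moves of total damage at most P, without reference to a finite support.
  record Power (P : ℚ) (m : A → ℚ) : Set where
    field
      nonneg : ∀ v → 0ℚ ℚ.≤ m v
      bound  : ∀ L n → (∀ v → occ v L ≤ n) → S m L ℚ.≤ n · P

-- Walks of letters

-- (t , y , z) stands for the triple (t − y − z , y , z) of letter counts; recording the level t avoids a subtraction.
V : Set
V = ℕ × ℕ × ℕ

Letter : Set
Letter = Fin 3

letters : List Letter
letters = 0F ∷ 1F ∷ 2F ∷ []

infixl 6 _⊕_

_⊕_ : V → V → V
(t , y , z) ⊕ (t′ , y′ , z′) = (t + t′ , y + y′ , z + z′)

scale : ℕ → Letter → V
scale k 0F = (k , 0 , 0)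
scale k 1F = (k , k , 0)
scale k 2F = (k , 0 , k)

unit : Letter → V
unit = scale 1

disp : List Letter → V
disp []      = (0 , 0 , 0)
disp (l ∷ w) = unit l ⊕ disp w

walk : V → List Letter → List V
walk x []      = []
walk x (l ∷ w) = x ⊕ unit l ∷ walk (x ⊕ unit l) w

level : V → ℕ
level = proj₁

_≟ⱽ_ : DecidableEquality V
_≟ⱽ_ = ×-≡-dec ℕ._≟_ (×-≡-dec ℕ._≟_ ℕ._≟_)

open Occurrences _≟ⱽ_

triple : ∀ {a b c a′ b′ c′ : ℕ} → a ≡ a′ → b ≡ b′ → c ≡ c′ → (a , b , c) ≡ (a′ , b′ , c′)
triple refl refl refl = refl

⊕-assoc : ∀ x y z → x ⊕ y ⊕ z ≡ x ⊕ (y ⊕ z)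
⊕-assoc (a , b , c) (d , e , f) (g , h , i) = triple (+-assoc a d g) (+-assoc b e h) (+-assoc c f i)

⊕-identityʳ : ∀ x → x ⊕ (0 , 0 , 0) ≡ x
⊕-identityʳ (a , b , c) = triple (+-identityʳ a) (+-identityʳ b) (+-identityʳ c)

⊕-cancelˡ : ∀ x {y z} → x ⊕ y ≡ x ⊕ z → y ≡ z
⊕-cancelˡ (a , b , c) {d , e , f} {g , h , i} eq with p , q ← ,-injective eq with q , r ← ,-injective q =
  triple (+-cancelˡ-≡ a d g p) (+-cancelˡ-≡ b e h q) (+-cancelˡ-≡ c f i r)

⊕-cancelʳ : ∀ {x y} z → x ⊕ z ≡ y ⊕ z → x ≡ y
⊕-cancelʳ {a , b , c} {d , e , f} (g , h , i) eq with p , q ← ,-injective eq with q , r ← ,-injective q =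
  triple (+-cancelʳ-≡ g a d p) (+-cancelʳ-≡ h b e q) (+-cancelʳ-≡ i c f r)

level-scale : ∀ k c → level (scale k c) ≡ k
level-scale k 0F = refl
level-scale k 1F = refl
level-scale k 2F = refl

scale-injective : ∀ {i j} c d → scale (suc i) c ≡ scale (suc j) d → c ≡ d
scale-injective 0F 0F _ = refl
scale-injective 1F 1F _ = refl
scale-injective 2F 2F _ = refl
scale-injective 0F 1F ()
scale-injective 0F 2F ()
scale-injective 1F 0F ()
scale-injective 1F 2F ()
scale-injective 2F 0F ()
scale-injective 2F 1F ()

level-disp : ∀ w → level (disp w) ≡ length w
level-disp []      = refl
level-disp (l ∷ w) = cong₂ _+_ (level-scale 1 l) (level-disp w)

disp-++ : ∀ u w → disp (u ++ w) ≡ disp u ⊕ disp w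
disp-++ []      w = refl
disp-++ (l ∷ u) w = trans (cong (unit l ⊕_) (disp-++ u w)) (sym (⊕-assoc (unit l) (disp u) (disp w)))

disp-replicate : ∀ k c → disp (replicate k c) ≡ scale k c
disp-replicate zero    0F = refl
disp-replicate zero    1F = refl
disp-replicate zero    2F = refl
disp-replicate (suc k) 0F = cong (unit 0F ⊕_) (disp-replicate k 0F)
disp-replicate (suc k) 1F = cong (unit 1F ⊕_) (disp-replicate k 1F)
disp-replicate (suc k) 2F = cong (unit 2F ⊕_) (disp-replicate k 2F)

walk-++ : ∀ x u w → walk x (u ++ w) ≡ walk x u ++ walk (x ⊕ disp u) w
walk-++ x []      w = cong (λ y → walk y w) (sym (⊕-identityʳ x))
walk-++ x (l ∷ u) w = cong (x ⊕ unit l ∷_) (trans (walk-++ (x ⊕ unit l) u w)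
  (cong (λ y → walk (x ⊕ unit l) u ++ walk y w) (⊕-assoc x (unit l) (disp u))))

∈-walk : ∀ {v} x w → v ∈ walk x w → ∃ λ j → j < length w × v ≡ x ⊕ disp (take (suc j) w)
∈-walk x (l ∷ w) (here refl) = 0 , s≤s z≤n , cong (x ⊕_) (sym (⊕-identityʳ (unit l)))
∈-walk x (l ∷ w) (there v∈) with j , j<w , refl ← ∈-walk (x ⊕ unit l) w v∈ =
  suc j , s≤s j<w , ⊕-assoc x (unit l) (disp (take (suc j) w))

length-take-< : ∀ {j} (w : List Letter) → j < length w → length (take (suc j) w) ≡ suc j
length-take-< {j} w j<w = trans (ListP.length-take (suc j) w) (m≤n⇒m⊓n≡m j<w)

level-⊕ : ∀ x y → level (x ⊕ y) ≡ level x + level y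
level-⊕ (_ , _ , _) (_ , _ , _) = refl

∈-walk-level : ∀ {v} x w {j} → j < length w → v ≡ x ⊕ disp (take (suc j) w) → level v ≡ level x + suc j
∈-walk-level x w {j} j<w refl = trans (level-⊕ x (disp (take (suc j) w)))
  (cong (level x +_) (trans (level-disp (take (suc j) w)) (length-take-< w j<w)))

-- Every step raises the level, so a walk never returns to a vertex.
occ-walk≤1 : ∀ v x w → occ v (walk x w) ≤ 1
occ-walk≤1 v x []      = z≤n
occ-walk≤1 v x (l ∷ w) with v ≟ⱽ (x ⊕ unit l)
... | no _     = occ-walk≤1 v (x ⊕ unit l) w
... | yes refl with ≡0-or-0< (occ (x ⊕ unit l) (walk (x ⊕ unit l) w))
...   | inj₁ e = s≤s (≤-reflexive e)
...   | inj₂ p with j , j<w , e ← ∈-walk (x ⊕ unit l) w (0<occ⇒∈ (walk (x ⊕ unit l) w) p) =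
  ⊥-elim (m≢1+m+n (level (x ⊕ unit l)) (trans (∈-walk-level (x ⊕ unit l) w j<w e) (+-suc _ j)))

∈-walk-replicate : ∀ {v} x k c → v ∈ walk x (replicate k c) → ∃ λ i → i < k × v ≡ x ⊕ scale (suc i) c
∈-walk-replicate x k c v∈ with i , i<k , e ← ∈-walk x (replicate k c) v∈ =
  i , i<k′ , trans e (cong (x ⊕_) (trans (cong disp (take-replicate′ (suc i) k i<k′)) (disp-replicate (suc i) c)))
  where
  i<k′ = subst (i <_) (ListP.length-replicate k) i<k
  take-replicate′ : ∀ i k → i ≤ k → take i (replicate k c) ≡ replicate i c
  take-replicate′ zero    k       _       = refl
  take-replicate′ (suc i) (suc k) (s≤s p) = cong (c ∷_) (take-replicate′ i k p)

-- The level of `v` fixes its place in both walks. Inside the run, its displacement from `s` is a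
-- positive multiple of the letter; after the run, the common prefix of `u` cancels and leaves
-- `scale k c` to be compared with `scale k d`.
run-determined : ∀ {v k} s → 0 < k → ∀ u {c d} → v ∈ walk s (replicate k c ++ u) → v ∈ walk s (replicate k d ++ u) → c ≡ d
run-determined {v} {suc k} s _ u {c} {d} v∈c v∈d = cases (split c v∈c) (split d v∈d)
  where
  after : Letter → V
  after e = s ⊕ scale (suc k) e
  level-after : ∀ e → level (after e) ≡ level s + suc k
  level-after e = trans (level-⊕ s (scale (suc k) e)) (cong (level s +_) (level-scale (suc k) e))
  split : ∀ e → v ∈ walk s (replicate (suc k) e ++ u) → v ∈ walk s (replicate (suc k) e) ⊎ v ∈ walk (after e) u
  split e v∈ = ∈-++⁻ (walk s (replicate (suc k) e))
    (subst (v ∈_) (trans (walk-++ s (replicate (suc k) e) u)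
      (cong (λ y → walk s (replicate (suc k) e) ++ walk (s ⊕ y) u) (disp-replicate (suc k) e))) v∈)
  mixed : ∀ {c d} → v ∈ walk s (replicate (suc k) c) → v ∈ walk (after d) u → ⊥
  mixed {c} {d} p q with i , i<k , e ← ∈-walk-replicate s (suc k) c p with j , j<u , f ← ∈-walk (after d) u q =
    <-irrefl i≡k+j (<-≤-trans i<k (m≤m+n (suc k) j))
    where
    open ≡-Reasoning
    i≡k+j : i ≡ suc k + j
    i≡k+j = suc-injective (+-cancelˡ-≡ (level s) (suc i) (suc (suc k) + j) (begin
      level s + suc i                   ≡⟨ cong (level s +_) (sym (level-scale (suc i) c)) ⟩
      level s + level (scale (suc i) c) ≡⟨ sym (level-⊕ s (scale (suc i) c)) ⟩
      level (s ⊕ scale (suc i) c)       ≡⟨ cong level (sym e) ⟩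
      level v                           ≡⟨ ∈-walk-level (after d) u j<u f ⟩
      level (after d) + suc j           ≡⟨ cong (_+ suc j) (level-after d) ⟩
      level s + suc k + suc j           ≡⟨ +-assoc (level s) (suc k) (suc j) ⟩
      level s + (suc k + suc j)         ≡⟨ cong (level s +_) (+-suc (suc k) j) ⟩
      level s + (suc (suc k) + j)       ∎))
  cases : v ∈ walk s (replicate (suc k) c) ⊎ v ∈ walk (after c) u →
          v ∈ walk s (replicate (suc k) d) ⊎ v ∈ walk (after d) u → c ≡ d
  cases (inj₁ p) (inj₂ q) = ⊥-elim (mixed {c} {d} p q)
  cases (inj₂ p) (inj₁ q) = ⊥-elim (mixed {d} {c} q p)
  cases (inj₁ p) (inj₁ q) with i , _ , e ← ∈-walk-replicate s (suc k) c p with j , _ , f ← ∈-walk-replicate s (suc k) d q =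
    scale-injective c d (⊕-cancelˡ s (trans (sym e) f))
  cases (inj₂ p) (inj₂ q) with i , i<u , e ← ∈-walk (after c) u p with j , j<u , f ← ∈-walk (after d) u q =
    scale-injective c d (⊕-cancelˡ s (⊕-cancelʳ (disp (take (suc i) u))
      (trans (sym e) (trans f (cong (λ m → after d ⊕ disp (take (suc m) u)) (sym i≡j))))))
    where
    open ≡-Reasoning
    i≡j : i ≡ j
    i≡j = suc-injective (+-cancelˡ-≡ (level s + suc k) (suc i) (suc j) (begin
      level s + suc k + suc i ≡⟨ cong (_+ suc i) (sym (level-after c)) ⟩
      level (after c) + suc i ≡⟨ sym (∈-walk-level (after c) u i<u e) ⟩
      level v                 ≡⟨ ∈-walk-level (after d) u j<u f ⟩
      level (after d) + suc j ≡⟨ cong (_+ suc j) (level-after d) ⟩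
      level s + suc k + suc j ∎))

division-< : ∀ k {q q′ r r′} → r < k → q < q′ → k * q + r < k * q′ + r′
division-< k {q} {q′} {r} {r′} r<k q<q′ = begin-strict
  k * q + r   <⟨ +-monoʳ-< (k * q) r<k ⟩
  k * q + k   ≡⟨ trans (+-comm (k * q) k) (sym (*-suc k q)) ⟩
  k * suc q   ≤⟨ *-monoʳ-≤ k q<q′ ⟩
  k * q′      ≤⟨ m≤m+n _ r′ ⟩
  k * q′ + r′ ∎
  where open ≤-Reasoning

division-unique : ∀ k {q q′ r r′} → r < k → r′ < k → k * q + r ≡ k * q′ + r′ → q ≡ q′ × r ≡ r′
division-unique k {q} {q′} {r} {r′} r<k r′<k eq with <-cmp q q′
... | tri≈ _ refl _ = refl , +-cancelˡ-≡ (k * q) r r′ eq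
... | tri< q<q′ _ _ = ⊥-elim (<-irrefl eq (division-< k r<k q<q′))
... | tri> _ _ q′<q = ⊥-elim (<-irrefl (sym eq) (division-< k r′<k q′<q))

-- Blocks: fine paths realising one coarse move

occ-Unique : {A : Set} (_≟_ : DecidableEquality A) {xs : List A} → Unique xs → ∀ x → Occurrences.occ _≟_ x xs ≤ 1
occ-Unique _≟_ []                    x = z≤n
occ-Unique _≟_ {y ∷ ys} (y∉ys ∷ uniq) x with x ≟ y
... | no _     = occ-Unique _≟_ uniq x
... | yes refl = s≤s (≤-reflexive (absent y∉ys))
  where
  absent : ∀ {zs} → All (λ z → ¬ y ≡ z) zs → Occurrences.occ _≟_ y zs ≡ 0
  absent []       = refl
  absent {z ∷ _} (y≢z ∷ ps) with y ≟ z
  ... | yes y≡z = ⊥-elim (y≢z y≡z)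
  ... | no _    = absent ps

occ-letters≤1 : ∀ c → Occurrences.occ FinP._≟_ c letters ≤ 1
occ-letters≤1 0F = ≤-refl
occ-letters≤1 1F = ≤-refl
occ-letters≤1 2F = ≤-refl

+-exclusive : ∀ {a b k} → a ≤ k → b ≤ k → (0 < a → 0 < b → ⊥) → a + b ≤ k
+-exclusive {zero}          _   b≤k _  = b≤k
+-exclusive {suc a} {zero}  a≤k _   _  = ≤-trans (≤-reflexive (+-identityʳ (suc a))) a≤k
+-exclusive {suc a} {suc b} _   _   ex = ⊥-elim (ex (s≤s z≤n) (s≤s z≤n))

length-cartesianProduct : {A B : Set} (xs : List A) (ys : List B) → length (cartesianProduct xs ys) ≡ length xs * length ys
length-cartesianProduct []       ys = refl
length-cartesianProduct (x ∷ xs) ys = trans (ListP.length-++ (map (x ,_) ys))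
  (cong₂ _+_ (ListP.length-map (x ,_) ys) (length-cartesianProduct xs ys))

module BlockPaths (n A R : ℕ) (A≡ : A ≡ suc n) (R≡ : R ≡ A + ((n + n) + (n + n))) where

  N : ℕ
  N = A * A

  0<A : 0 < A
  0<A = subst (0 <_) (sym A≡) (s≤s z≤n)

  Offset : Set
  Offset = Fin A × Fin A

  offsets : List Offset
  offsets = cartesianProduct (allFin A) (allFin A)

  length-offsets : length offsets ≡ N
  length-offsets = trans (length-cartesianProduct (allFin A) (allFin A))
    (cong₂ _*_ (ListP.length-tabulate {n = A} (λ i → i)) (ListP.length-tabulate {n = A} (λ i → i)))

  _≟ᴼ_ : DecidableEquality Offset
  _≟ᴼ_ = ×-≡-dec FinP._≟_ FinP._≟_

  occ-offsets≤1 : ∀ o → Occurrences.occ _≟ᴼ_ o offsets ≤ 1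
  occ-offsets≤1 = occ-Unique _≟ᴼ_ (UniqueP.cartesianProduct⁺ (UniqueP.allFin⁺ A) (UniqueP.allFin⁺ A))

  0ᴼ : Offset
  0ᴼ = Fin.fromℕ< 0<A , Fin.fromℕ< 0<A

  embed : Offset → V
  embed (o₁ , o₂) = (0 , toℕ o₁ , toℕ o₂)

  -- A block consists of `A` moves in the coarse letter and of `out` and `back`, which together
  -- shift each lateral coordinate by `n` plus the change of offset; hence the drift `n * t`. All
  -- offsets are below the spacing `A`, so they can be read off as remainders.
  base : V → V
  base (t , y , z) = (R * t , A * y + n * t , A * z + n * t)

  start : V → Offset → V
  start Z o = base Z ⊕ embed o

  -- The padding by `0F` gives `out` and `back` the length `n + n` for every offset, so that the
  -- level of a vertex tells its place in the block.
  out : Offset → List Letter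
  out (o₁ , o₂) = replicate (toℕ o₁) 1F ++ replicate (toℕ o₂) 2F ++ replicate ((n ∸ toℕ o₁) + (n ∸ toℕ o₂)) 0F

  back : Offset → List Letter
  back (o₁ , o₂) = replicate (n ∸ toℕ o₁) 1F ++ replicate (n ∸ toℕ o₂) 2F ++ replicate (toℕ o₁ + toℕ o₂) 0F

  -- Leads from offset o to offset o′.  Its first part does not depend on o, and its last part not on o′.
  word : Letter → Offset → Offset → List Letter
  word c o o′ = replicate A c ++ (out o′ ++ back o)

  path : V → Letter → Offset → Offset → List V
  path Z c o o′ = walk (start Z o) (word c o o′)

  fan : V → Offset → List V
  fan Z o = concatMap (λ o′ → concatMap (λ c → path Z c o o′) letters) offsets

  region : V → List V
  region Z = concatMap (fan Z) offsets

  complement : (o : Fin A) → toℕ o + (n ∸ toℕ o) ≡ n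
  complement o = m+[n∸m]≡n (ℕP.≤-pred (subst (toℕ o <_) A≡ (FinP.toℕ<n o)))

  disp-three : ∀ p q r → disp (replicate p 1F ++ replicate q 2F ++ replicate r 0F) ≡ (p + (q + r) , p , q)
  disp-three p q r = begin
    disp (replicate p 1F ++ replicate q 2F ++ replicate r 0F)
      ≡⟨ disp-++ (replicate p 1F) _ ⟩
    disp (replicate p 1F) ⊕ disp (replicate q 2F ++ replicate r 0F)
      ≡⟨ cong₂ _⊕_ (disp-replicate p 1F) (trans (disp-++ (replicate q 2F) _) (cong₂ _⊕_ (disp-replicate q 2F) (disp-replicate r 0F))) ⟩
    (p + (q + r) , p + 0 , 0 + (q + 0))
      ≡⟨ triple refl (+-identityʳ p) (+-identityʳ q) ⟩
    (p + (q + r) , p , q) ∎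
    where open ≡-Reasoning

  disp-out : ∀ o → disp (out o) ≡ (n + n , 0 , 0) ⊕ embed o
  disp-out (o₁ , o₂) = trans (disp-three (toℕ o₁) (toℕ o₂) _) (triple
    (trans (rearrange (toℕ o₁) (toℕ o₂) (n ∸ toℕ o₁) (n ∸ toℕ o₂)) (trans (cong₂ _+_ (complement o₁) (complement o₂)) (sym (+-identityʳ (n + n))))) refl refl)
    where
    rearrange : ∀ a b c d → a + (b + (c + d)) ≡ (a + c) + (b + d)
    rearrange = solve-∀

  disp-back : ∀ o₁ o₂ → disp (back (o₁ , o₂)) ≡ (n + n , n ∸ toℕ o₁ , n ∸ toℕ o₂)
  disp-back o₁ o₂ = trans (disp-three (n ∸ toℕ o₁) (n ∸ toℕ o₂) _) (triple
    (trans (rearrange (toℕ o₁) (toℕ o₂) (n ∸ toℕ o₁) (n ∸ toℕ o₂)) (cong₂ _+_ (complement o₁) (complement o₂))) refl refl)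
    where
    rearrange : ∀ a b c d → c + (d + (a + b)) ≡ (a + c) + (b + d)
    rearrange = solve-∀

  length-out : ∀ o → length (out o) ≡ n + n
  length-out o = trans (sym (level-disp (out o))) (trans (cong level (disp-out o)) (+-identityʳ (n + n)))

  length-back : ∀ o → length (back o) ≡ n + n
  length-back (o₁ , o₂) = trans (sym (level-disp (back (o₁ , o₂)))) (cong level (disp-back o₁ o₂))

  length-word : ∀ c o o′ → length (word c o o′) ≡ R
  length-word c o o′ = trans (ListP.length-++ (replicate A c)) (trans (cong₂ _+_ (ListP.length-replicate A)
    (trans (ListP.length-++ (out o′)) (cong₂ _+_ (length-out o′) (length-back o)))) (sym R≡))

  scale-coordinates : ∀ k c → scale k c ≡ (k , k * proj₁ (proj₂ (unit c)) , k * proj₂ (proj₂ (unit c)))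
  scale-coordinates k 0F = triple refl (sym (*-zeroʳ k)) (sym (*-zeroʳ k))
  scale-coordinates k 1F = triple refl (sym (*-identityʳ k)) (sym (*-zeroʳ k))
  scale-coordinates k 2F = triple refl (sym (*-zeroʳ k)) (sym (*-identityʳ k))

  middle : Letter → Offset → V
  middle c o = (n + n , 0 , 0) ⊕ scale A c ⊕ embed o

  -- Displacements commute, so the two offsets can trade places: the second half of a path is a walk
  -- from `start Z o′`, shifted by a vector that depends only on `c` and `o`. It can thus be counted
  -- in the same way as the first half.
  disp-run-out : ∀ Z c o o′ → start Z o ⊕ disp (replicate A c ++ out o′) ≡ start Z o′ ⊕ middle c o
  disp-run-out Z c o o′ = begin
    start Z o ⊕ disp (replicate A c ++ out o′)
      ≡⟨ cong (start Z o ⊕_) (trans (disp-++ (replicate A c) (out o′)) (cong₂ _⊕_ (disp-replicate A c) (disp-out o′))) ⟩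
    base Z ⊕ embed o ⊕ (scale A c ⊕ ((n + n , 0 , 0) ⊕ embed o′))
      ≡⟨ lemma (base Z) (embed o) (scale A c) (n + n , 0 , 0) (embed o′) ⟩
    base Z ⊕ embed o′ ⊕ ((n + n , 0 , 0) ⊕ scale A c ⊕ embed o) ∎
    where
    open ≡-Reasoning
    coordinate : ∀ a b c d e → a + b + (c + (d + e)) ≡ a + e + (d + c + b)
    coordinate = solve-∀
    lemma : ∀ a b c d e → a ⊕ b ⊕ (c ⊕ (d ⊕ e)) ≡ a ⊕ e ⊕ (d ⊕ c ⊕ b)
    lemma (a , a′ , a″) (b , b′ , b″) (c , c′ , c″) (d , d′ , d″) (e , e′ , e″) =
      triple (coordinate a b c d e) (coordinate a′ b′ c′ d′ e′) (coordinate a″ b″ c″ d″ e″)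

  path-split : ∀ Z c o o′ → path Z c o o′ ≡ walk (start Z o) (replicate A c ++ out o′) ++ walk (start Z o′ ⊕ middle c o) (back o)
  path-split Z c o o′ = trans (cong (walk (start Z o)) (sym (ListP.++-assoc (replicate A c) (out o′) (back o))))
    (trans (walk-++ (start Z o) (replicate A c ++ out o′) (back o))
      (cong (λ y → walk (start Z o) (replicate A c ++ out o′) ++ walk y (back o)) (disp-run-out Z c o o′)))

  path-end : ∀ Z c o o′ → start Z o ⊕ disp (word c o o′) ≡ start (Z ⊕ unit c) o′
  path-end Z@(t , y , z) c o@(o₁ , o₂) o′@(o₁′ , o₂′) = begin
    start Z o ⊕ disp (word c o o′)
      ≡⟨ cong (λ w → start Z o ⊕ disp w) (sym (ListP.++-assoc (replicate A c) (out o′) (back o))) ⟩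
    start Z o ⊕ disp ((replicate A c ++ out o′) ++ back o)
      ≡⟨ cong (start Z o ⊕_) (disp-++ (replicate A c ++ out o′) (back o)) ⟩
    start Z o ⊕ (disp (replicate A c ++ out o′) ⊕ disp (back o))
      ≡⟨ sym (⊕-assoc (start Z o) _ _) ⟩
    start Z o ⊕ disp (replicate A c ++ out o′) ⊕ disp (back o)
      ≡⟨ cong₂ _⊕_ (disp-run-out Z c o o′) (disp-back o₁ o₂) ⟩
    start Z o′ ⊕ ((n + n , 0 , 0) ⊕ scale A c ⊕ embed o) ⊕ (n + n , n ∸ toℕ o₁ , n ∸ toℕ o₂)
      ≡⟨ cong (λ s → start Z o′ ⊕ ((n + n , 0 , 0) ⊕ s ⊕ embed o) ⊕ (n + n , n ∸ toℕ o₁ , n ∸ toℕ o₂)) (scale-coordinates A c) ⟩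
    start Z o′ ⊕ ((n + n , 0 , 0) ⊕ (A , A * a , A * b) ⊕ embed o) ⊕ (n + n , n ∸ toℕ o₁ , n ∸ toℕ o₂)
      ≡⟨ triple (time R (n + n) A t R≡)
                (space A n t y a (toℕ o₁′) (toℕ o₁) (n ∸ toℕ o₁) (complement o₁))
                (space A n t z b (toℕ o₂′) (toℕ o₂) (n ∸ toℕ o₂) (complement o₂)) ⟩
    (R * (t + 1) + 0 , A * (y + a) + n * (t + 1) + toℕ o₁′ , A * (z + b) + n * (t + 1) + toℕ o₂′)
      ≡⟨ cong (λ s → (R * (t + s) + 0 , A * (y + a) + n * (t + s) + toℕ o₁′ , A * (z + b) + n * (t + s) + toℕ o₂′)) (sym (level-scale 1 c)) ⟩
    start (Z ⊕ unit c) o′ ∎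
    where
    open ≡-Reasoning
    a = proj₁ (proj₂ (unit c))
    b = proj₂ (proj₂ (unit c))
    time : ∀ r m k t → r ≡ k + (m + m) → r * t + 0 + (m + k + 0) + m ≡ r * (t + 1) + 0
    time r m k t refl = solved m k t
      where
      solved : ∀ m k t → (k + (m + m)) * t + 0 + (m + k + 0) + m ≡ (k + (m + m)) * (t + 1) + 0
      solved = solve-∀
    space : ∀ k m t y a o′ o d → o + d ≡ m → k * y + m * t + o′ + (0 + k * a + o) + d ≡ k * (y + a) + m * (t + 1) + o′
    space k m t y a o′ o d refl = solved k t y a o′ o d
      where
      solved : ∀ k t y a o′ o d → k * y + (o + d) * t + o′ + (0 + k * a + o) + d ≡ k * (y + a) + (o + d) * (t + 1) + o′
      solved = solve-∀

  -- A fine level is `R` times the coarse level plus a place from 1 to `R`; lowering the place by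
  -- one makes it a remainder modulo `R`.
  level-unique : ∀ (Z Z′ : V) (o o′ : Offset) {x y i j} → level x ≡ suc i → level y ≡ suc j → i < R → j < R →
                 level (start Z o ⊕ x) ≡ level (start Z′ o′ ⊕ y) → level Z ≡ level Z′ × i ≡ j
  level-unique (t , _) (t′ , _) o o′ {_ , _} {_ , _} {i} {j} refl refl i<R j<R eq =
    division-unique R {t} {t′} i<R j<R (suc-injective (trans (shift (R * t) i) (trans eq (sym (shift (R * t′) j)))))
    where
    shift : ∀ m i → suc (m + i) ≡ m + 0 + suc i
    shift = solve-∀

  lateral-injective : ∀ m {y y′} (o o′ : Fin A) → A * y + m + toℕ o ≡ A * y′ + m + toℕ o′ → y ≡ y′ × o ≡ o′
  lateral-injective m {y} {y′} o o′ e =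
    let y≡y′ , o≡o′ = division-unique A (FinP.toℕ<n o) (FinP.toℕ<n o′) (+-cancelʳ-≡ m _ _
          (trans (exchange (A * y) (toℕ o) m) (trans e (exchange (A * y′) m (toℕ o′)))))
    in y≡y′ , FinP.toℕ-injective o≡o′
    where
    exchange : ∀ a b c → a + b + c ≡ a + c + b
    exchange = solve-∀

  start-injective : ∀ {Z Z′ : V} {o o′ : Offset} → level Z ≡ level Z′ → start Z o ≡ start Z′ o′ → Z ≡ Z′ × o ≡ o′
  start-injective {t , y , z} {_ , y′ , z′} {o₁ , o₂} {o₁′ , o₂′} refl eq
    with _ , eq′ ← ,-injective eq with p , q ← ,-injective eq′
    with refl , refl ← lateral-injective (n * t) {y} {y′} o₁ o₁′ p
    with refl , refl ← lateral-injective (n * t) {z} {z′} o₂ o₂′ q = refl , refl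

  level-suffix : ∀ w u {i} → i < length u → level (w ⊕ disp (take (suc i) u)) ≡ suc (level w + i)
  level-suffix w u {i} i<u = trans (∈-walk-level w u i<u refl) (+-suc (level w) i)

  -- The walk stays within one block, so the level of `v` gives the coarse level and the place. The
  -- common displacement then cancels, and `start-injective` recovers the coarse vertex and the
  -- offset by division by `A`.
  walk-determined : ∀ {v Z Z′ o o′} w u → level w + length u ≤ R →
                    v ∈ walk (start Z o ⊕ w) u → v ∈ walk (start Z′ o′ ⊕ w) u → Z ≡ Z′ × o ≡ o′
  walk-determined {v} {Z} {Z′} {o} {o′} w u fits p q
    with i , i<u , e ← ∈-walk (start Z o ⊕ w) u p
    with j , j<u , f ← ∈-walk (start Z′ o′ ⊕ w) u q
    with lv , ij ← level-unique Z Z′ o o′ {w ⊕ disp (take (suc i) u)} {w ⊕ disp (take (suc j) u)} (level-suffix w u i<u) (level-suffix w u j<u)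
                   (<-≤-trans (+-monoʳ-< (level w) i<u) fits) (<-≤-trans (+-monoʳ-< (level w) j<u) fits)
                   (cong level (trans (sym (⊕-assoc (start Z o) w _)) (trans (sym e) (trans f (⊕-assoc (start Z′ o′) w _)))))
    with refl ← +-cancelˡ-≡ (level w) i j ij
    = start-injective lv (⊕-cancelʳ w (⊕-cancelʳ (disp (take (suc i) u)) (trans (sym e) f)))

  module O = Occurrences _≟ᴼ_
  module L = Occurrences (FinP._≟_ {3})

  starts-bound : ∀ {m} v L w u → level w + length u ≤ R → (∀ Z → occ Z L ≤ m) →
                 ∑ (λ Z → ∑ (λ o → occ v (walk (start Z o ⊕ w) u)) offsets) L ≤ m
  starts-bound v L w u fits bounded = ∑-unique _ L
    (λ Z → O.∑-unique _ offsets (λ o → occ-walk≤1 v _ u)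
      (λ {o} {o′} p q → proj₂ (walk-determined {o = o} {o′} w u fits (0<occ⇒∈ (walk (start Z o ⊕ w) u) p) (0<occ⇒∈ (walk (start Z o′ ⊕ w) u) q))) occ-offsets≤1)
    same bounded
    where
    same : ∀ {Z Z′} → 0 < ∑ (λ o → occ v (walk (start Z o ⊕ w) u)) offsets →
           0 < ∑ (λ o → occ v (walk (start Z′ o ⊕ w) u)) offsets → Z ≡ Z′
    same {Z} {Z′} p q with o , _ , p′ ← 0<∑⇒∃ _ offsets p with o′ , _ , q′ ← 0<∑⇒∃ _ offsets q =
      proj₁ (walk-determined {o = o} {o′} w u fits (0<occ⇒∈ (walk (start Z o ⊕ w) u) p′) (0<occ⇒∈ (walk (start Z′ o′ ⊕ w) u) q′))

  first second : V → V → Letter → Offset → Offset → ℕ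
  first  v Z c o o′ = occ v (walk (start Z o ⊕ (0 , 0 , 0)) (replicate A c ++ out o′))
  second v Z c o o′ = occ v (walk (start Z o′ ⊕ middle c o) (back o))

  occ-path : ∀ v Z c o o′ → occ v (path Z c o o′) ≡ first v Z c o o′ + second v Z c o o′
  occ-path v Z c o o′ = trans (cong (occ v) (path-split Z c o o′)) (trans (∑-++ _ (walk (start Z o) (replicate A c ++ out o′)) _)
    (cong (λ s → occ v (walk s (replicate A c ++ out o′)) + second v Z c o o′) (sym (⊕-identityʳ (start Z o)))))

  level-middle : ∀ c o → level (middle c o) ≡ A + (n + n)
  level-middle c o = trans (+-identityʳ _) (trans (cong ((n + n) +_) (level-scale A c)) (+-comm (n + n) A))

  length-run-out : ∀ c o → length (replicate A c ++ out o) ≡ A + (n + n)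
  length-run-out c o = trans (ListP.length-++ (replicate A c)) (cong₂ _+_ (ListP.length-replicate A) (length-out o))

  first-fits : ∀ c o → 0 + length (replicate A c ++ out o) ≤ R
  first-fits c o = ≤-trans (≤-reflexive (length-run-out c o)) (≤-trans (+-monoʳ-≤ A (m≤m+n (n + n) (n + n))) (≤-reflexive (sym R≡)))

  second-fits : ∀ c o → level (middle c o) + length (back o) ≤ R
  second-fits c o = ≤-reflexive (trans (cong₂ _+_ (level-middle c o) (length-back o)) (trans (+-assoc A (n + n) (n + n)) (sym R≡)))

  -- First halves occupy the first `A + (n + n)` places of a block, second halves the remaining
  -- ones.
  disjoint : ∀ {v} Z c o o′ Z₁ c₁ o₁ o₁′ → 0 < first v Z c o o′ → 0 < second v Z₁ c₁ o₁ o₁′ → ⊥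
  disjoint Z c o o′ Z₁ c₁ o₁ o₁′ p q
    with i , i<u , e ← ∈-walk (start Z o ⊕ (0 , 0 , 0)) (replicate A c ++ out o′) (0<occ⇒∈ (walk (start Z o ⊕ (0 , 0 , 0)) (replicate A c ++ out o′)) p)
    with j , j<u , f ← ∈-walk (start Z₁ o₁′ ⊕ middle c₁ o₁) (back o₁) (0<occ⇒∈ (walk (start Z₁ o₁′ ⊕ middle c₁ o₁) (back o₁)) q)
    with _ , i≡ ← level-unique Z Z₁ o o₁′ {(0 , 0 , 0) ⊕ disp (take (suc i) (replicate A c ++ out o′))} {middle c₁ o₁ ⊕ disp (take (suc j) (back o₁))}
           (∈-walk-level (0 , 0 , 0) (replicate A c ++ out o′) i<u refl)
           (trans (∈-walk-level (middle c₁ o₁) (back o₁) j<u refl) (+-suc _ j))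
           (<-≤-trans i<u (first-fits c o′))
           (<-≤-trans (+-monoʳ-< (level (middle c₁ o₁)) j<u) (second-fits c₁ o₁))
           (cong level (trans (sym (⊕-assoc (start Z o) (0 , 0 , 0) _)) (trans (sym e) (trans f (⊕-assoc (start Z₁ o₁′) (middle c₁ o₁) _)))))
    = <-irrefl i≡ (<-≤-trans i<u (≤-trans (≤-reflexive (trans (length-run-out c o′) (sym (level-middle c₁ o₁)))) (m≤m+n _ j)))

  -- Fixing v, the first half of a path through v is determined by c and o′, the second half by c and o.
  region-bound : ∀ {m} v L → (∀ Z → occ Z L ≤ m) → occ v (concatMap region L) ≤ m * (3 * N)
  region-bound {m} v L bounded = ≤-trans (≤-reflexive expand) (+-exclusive F≤ G≤ exclusive)
    where
    open ≤-Reasoning hiding (start)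
    total : (V → Letter → Offset → Offset → ℕ) → ℕ
    total h = ∑ (λ Z → ∑ (λ o → ∑ (λ o′ → ∑ (λ c → h Z c o o′) letters) offsets) offsets) L
    F = total (first v)
    G = total (second v)
    expand : occ v (concatMap region L) ≡ F + G
    expand = trans (∑-concatMap _ region L) (trans (∑-cong L λ Z → trans (∑-concatMap _ (fan Z) offsets)
      (trans (∑-cong offsets λ o → trans (∑-concatMap _ (λ o′ → concatMap (λ c → path Z c o o′) letters) offsets)
        (trans (∑-cong offsets λ o′ → trans (∑-concatMap _ (λ c → path Z c o o′) letters)
          (trans (∑-cong letters λ c → occ-path v Z c o o′) (∑-⊕ (λ c → first v Z c o o′) (λ c → second v Z c o o′) letters)))
        (∑-⊕ _ _ offsets))) (∑-⊕ _ _ offsets))) (∑-⊕ _ _ L))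
    hit : ∀ h → 0 < total h → ∃ λ Z → ∃ λ c → ∃ λ o → ∃ λ o′ → 0 < h Z c o o′
    hit h p with Z , _ , p ← 0<∑⇒∃ _ L p with o , _ , p ← 0<∑⇒∃ _ offsets p
      with o′ , _ , p ← 0<∑⇒∃ _ offsets p with c , _ , p ← 0<∑⇒∃ _ letters p = Z , c , o , o′ , p
    exclusive : 0 < F → 0 < G → ⊥
    exclusive p q =
      let Z , c , o , o′ , p′ = hit (first v) p
          Z₁ , c₁ , o₁ , o₁′ , q′ = hit (second v) q
      in disjoint Z c o o′ Z₁ c₁ o₁ o₁′ p′ q′
    3N : length offsets * (3 * m) ≡ m * (3 * N)
    3N = trans (cong (_* (3 * m)) length-offsets) (arrange N m)
      where
      arrange : ∀ N m → N * (3 * m) ≡ m * (3 * N)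
      arrange = solve-∀
    F≤ : F ≤ m * (3 * N)
    F≤ = begin
      F ≡⟨ ∑-cong L (λ Z → ∑-swap _ offsets offsets) ⟩
      ∑ (λ Z → ∑ (λ o′ → ∑ (λ o → ∑ (λ c → first v Z c o o′) letters) offsets) offsets) L ≡⟨ ∑-swap _ L offsets ⟩
      ∑ (λ o′ → ∑ (λ Z → ∑ (λ o → ∑ (λ c → first v Z c o o′) letters) offsets) L) offsets
        ≡⟨ ∑-cong offsets (λ o′ → trans (∑-cong L (λ Z → ∑-swap (λ o c → first v Z c o o′) offsets letters))
                                        (∑-swap (λ Z c → ∑ (λ o → first v Z c o o′) offsets) L letters)) ⟩
      ∑ (λ o′ → ∑ (λ c → ∑ (λ Z → ∑ (λ o → first v Z c o o′) offsets) L) letters) offsets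
        ≤⟨ ∑-≤-length offsets (λ o′ → ∑-≤-length letters (λ c → starts-bound v L (0 , 0 , 0) (replicate A c ++ out o′) (first-fits c o′) bounded)) ⟩
      length offsets * (3 * m) ≡⟨ 3N ⟩
      m * (3 * N) ∎
    G≤ : G ≤ m * (3 * N)
    G≤ = begin
      G ≡⟨ ∑-swap _ L offsets ⟩
      ∑ (λ o → ∑ (λ Z → ∑ (λ o′ → ∑ (λ c → second v Z c o o′) letters) offsets) L) offsets
        ≡⟨ ∑-cong offsets (λ o → trans (∑-cong L (λ Z → ∑-swap (λ o′ c → second v Z c o o′) offsets letters))
                                       (∑-swap (λ Z c → ∑ (λ o′ → second v Z c o o′) offsets) L letters)) ⟩
      ∑ (λ o → ∑ (λ c → ∑ (λ Z → ∑ (λ o′ → second v Z c o o′) offsets) L) letters) offsets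
        ≤⟨ ∑-≤-length offsets (λ o → ∑-≤-length letters (λ c → starts-bound v L (middle c o) (back o) (second-fits c o) bounded)) ⟩
      length offsets * (3 * m) ≡⟨ 3N ⟩
      m * (3 * N) ∎

  -- With both offsets fixed, the three words differ only in their initial run, so by
  -- `run-determined` at most one of them passes through `v`. This leaves one hit for each of the
  -- `N` final offsets.
  fan-bound : ∀ v Z o → occ v (fan Z o) ≤ N
  fan-bound v Z o = begin
    occ v (fan Z o) ≡⟨ ∑-concatMap _ (λ o′ → concatMap (λ c → path Z c o o′) letters) offsets ⟩
    ∑ (λ o′ → occ v (concatMap (λ c → path Z c o o′) letters)) offsets
      ≤⟨ ∑-≤-length offsets (λ o′ → ≤-trans (≤-reflexive (∑-concatMap _ (λ c → path Z c o o′) letters))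
           (L.∑-unique _ letters (λ c → occ-walk≤1 v (start Z o) (word c o o′))
             (λ {c} {d} p q → run-determined (start Z o) 0<A (out o′ ++ back o) (0<occ⇒∈ (path Z c o o′) p) (0<occ⇒∈ (path Z d o o′) q))
             occ-letters≤1)) ⟩
    length offsets * 1 ≡⟨ trans (*-identityʳ _) length-offsets ⟩
    N ∎
    where open ≤-Reasoning hiding (start)

-- The self-similar strategy

infixl 6 _⊞_

_⊞_ : (V → ℚ) → (V → ℚ) → V → ℚ
(D ⊞ m) v = D v ℚ.+ m v

Power-+ : ∀ {P Q a b} → Power P a → Power Q b → Power (P ℚ.+ Q) (a ⊞ b)
Power-+ {P} {Q} {a} {b} p q = record
  { nonneg = λ v → ℚP.+-mono-≤ (nonneg p v) (nonneg q v)
  ; bound  = λ L n h → ℚP.≤-trans (ℚP.≤-reflexive (S.∑-⊕ a b L))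
      (ℚP.≤-trans (ℚP.+-mono-≤ (bound p L n h) (bound q L n h)) (ℚP.≤-reflexive (sym (×-distrib-+ P Q n)))) }
  where open Power

S-zero : ∀ {A : Set} (xs : List A) → S (λ _ → 0ℚ) xs ≡ 0ℚ
S-zero = S.∑-ε

Power-0 : Power 0ℚ (λ _ → 0ℚ)
Power-0 = record
  { nonneg = λ _ → ℚP.≤-refl
  ; bound  = λ L n _ → ℚP.≤-trans (ℚP.≤-reflexive (S-zero L)) (·-nonneg n ℚP.≤-refl) }

collect : (V → List V) → (V → ℚ) → V → ℚ
collect reg m Z = S m (reg Z)

-- Replacing the entries of a list by their regions multiplies the multiplicity bound by at most
-- `k`. As `Power` is phrased by multiplicities, this is all there is to check.
Power-collect : ∀ {P m reg} k → (∀ {n} v L → (∀ Z → occ Z L ≤ n) → occ v (concatMap reg L) ≤ n * k) →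
                Power P m → Power (k · P) (collect reg m)
Power-collect {P} {m} {reg} k multiplicity p = record
  { nonneg = λ Z → S-nonneg (reg Z) (nonneg p)
  ; bound  = λ L n h → ℚP.≤-trans (ℚP.≤-reflexive (sym (S.∑-concatMap m reg L)))
      (ℚP.≤-trans (bound p (concatMap reg L) (n * k) (λ v → multiplicity v L h)) (ℚP.≤-reflexive (sym (×-assocˡ P n k)))) }
  where open Power

module Hierarchy (k A R K : ℕ) (A≡ : A ≡ suc (suc k)) (R≡ : R ≡ A + ((suc k + suc k) + (suc k + suc k)))
                 (K≡ : K ≡ 6 * R) (24R≤N : 24 * R ≤ A * A) where

  open BlockPaths (suc k) A R A≡ R≡ public

  Move : Set
  Move = V → ℚ

  coarse : Move → Move
  coarse = collect region

  -- In run cs Z o′ D B x l w, the current block realises the next move of the coarse play cs and leads to start Z o′.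
  -- D is the total damage, B the damage done during the block, and l ∷ w the rest of its word.
  data St : Set where
    initial : St
    run     : (cs : St) (Z : V) (o′ : Offset) (D B : Move) (x : V) (l : Letter) (w : List Letter) → St

  letter : St → Letter
  letter initial                 = 0F
  letter (run cs Z o′ D B x l w) = l

  pos : St → V
  pos initial                 = (0 , 0 , 0)
  pos (run cs Z o′ D B x l w) = x

  dmg : St → Move
  dmg initial                 = λ _ → 0ℚ
  dmg (run cs Z o′ D B x l w) = D

  target : St → V
  target st = pos st ⊕ unit (letter st)

  -- Summed over `o′`, the first term is at most `N` times the damage of the fan at `o`, and the
  -- second is twice the coarse damage of `Z ⊕ unit c`. The weights are such that a cost of `2 * c₂`
  -- times the power bounds the new fan by `c₂` times the power.
  cost : Move → V → Letter → Offset → Offset → ℚ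
  cost D Z c o o′ = N · S D (path Z c o o′) ℚ.+ 2 · S D (fan (Z ⊕ unit c) o′)

  newOffset : Move → V → Letter → Offset → Offset
  newOffset D Z c o = argmin (cost D Z c o) 0ᴼ offsets

  tailWord : Letter → Offset → Offset → List Letter
  tailWord c o o′ = replicate (suc k) c ++ (out o′ ++ back o)

  newBlock : St → V → Offset → Move → V → St
  newBlock cs Z o D x = run cs (Z ⊕ unit c) o′ D (λ _ → 0ℚ) x c (tailWord c o o′)
    where
    c  = letter cs
    o′ = newOffset D Z c o

  -- The first move at a level of the hierarchy creates the next level, still `initial`, above it.
  -- Each state is therefore finitely nested, and the call that advances the coarse play is
  -- structural.
  update : St → Move → St
  update initial                       m =
    -- The first block goes from the origin to `unit 0F` with both offsets zero. One letter of its
    -- run of `A` letters has been played and another is next, so `k` of them remain.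
    run initial (unit 0F) 0ᴼ m m (unit 0F) 0F (replicate k 0F ++ (out 0ᴼ ++ back 0ᴼ))
  update (run cs Z o′ D B x l (l′ ∷ w)) m = run cs Z o′ (D ⊞ m) (B ⊞ m) (x ⊕ unit l) l′ w
  update (run cs Z o′ D B x l [])       m = newBlock (update cs (coarse (B ⊞ m))) Z o′ (D ⊞ m) (x ⊕ unit l)

  -- The fixed point of the averaging, in units of the power: a fan bounded by `c₂` at the start of
  -- a block is bounded by `c₂ + R * N` at its end, and the average cost of the next offset is then
  -- at most `c₂ + R * N + 6 * (R * K)`, which has to be `2 * c₂`.
  c₂ : ℕ
  c₂ = 6 * (R * K) + R * N

  coarsePower : ℚ → ℚ
  coarsePower P = (3 * N * R) · P

  -- Here `i` counts Devil's moves during the block. Each adds at most `P` to the path and `N · P`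
  -- to the fan, whence the terms `i * N` in `path≤` and `fan≤`. By `D-coarse`, the damage that the
  -- coarse play has not yet seen is exactly that of `B`.
  record Block (P : ℚ) (cs : St) (Z : V) (o′ : Offset) (D B : Move) (x : V) (l : Letter) (w : List Letter) : Set where
    field
      0≤P      : 0ℚ ℚ.≤ P
      i        : ℕ
      elapsed  : i + suc (length w) ≡ R
      Z≡       : Z ≡ target cs
      o        : Offset
      done     : List V
      path≡    : path (pos cs) (letter cs) o o′ ≡ done ++ walk x (l ∷ w)
      end≡     : x ⊕ disp (l ∷ w) ≡ start Z o′
      D-nonneg : ∀ v → 0ℚ ℚ.≤ D v
      B-power  : Power (i · P) B
      D-coarse : ∀ z → dmg cs z ℚ.+ coarse B z ≡ coarse D z
      path≤    : N · S D (path (pos cs) (letter cs) o o′) ℚ.≤ (2 * c₂ + i * N) · P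
      fan≤     : S D (fan Z o′) ℚ.≤ (c₂ + i * N) · P

  -- The power occurs in the invariant but not in the moves. One strategy thus serves all powers,
  -- and the coarse play may face the larger `coarsePower P`, and so on upwards.
  Inv : ℚ → St → Set
  Inv P initial                 = 0ℚ ℚ.≤ P
  Inv P (run cs Z o′ D B x l w) = Inv (coarsePower P) cs × Block P cs Z o′ D B x l w

  -- With `K` equal to `6 * R`, the left side is at most 72 R² + 3 R N, and `24 * R ≤ A * A` brings
  -- this down to 6 R N.
  budget : ∀ {i} → i ≤ R → 2 * c₂ + i * N ≤ N * K
  budget {i} i≤R = begin
    2 * c₂ + i * N                       ≤⟨ +-monoʳ-≤ (2 * c₂) (*-monoˡ-≤ N i≤R) ⟩
    2 * (6 * (R * K) + R * N) + R * N    ≡⟨ cong (λ K → 2 * (6 * (R * K) + R * N) + R * N) K≡ ⟩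
    2 * (6 * (R * (6 * R)) + R * N) + R * N ≡⟨ expand R N ⟩
    3 * R * (24 * R) + 3 * (R * N)       ≤⟨ +-monoˡ-≤ (3 * (R * N)) (*-monoʳ-≤ (3 * R) 24R≤N) ⟩
    3 * R * N + 3 * (R * N)              ≡⟨ collapse R N ⟩
    N * (6 * R)                          ≡⟨ cong (N *_) (sym K≡) ⟩
    N * K                                ∎
    where
    open ≤-Reasoning hiding (start)
    expand : ∀ R N → 2 * (6 * (R * (6 * R)) + R * N) + R * N ≡ 3 * R * (24 * R) + 3 * (R * N)
    expand = solve-∀
    collapse : ∀ R N → 3 * R * N + 3 * (R * N) ≡ N * (6 * R)
    collapse = solve-∀

  0<N : 0 < N
  0<N = *-mono-≤ 0<A 0<A

  -- The next vertex lies on the path of the current block, whose total damage stays within the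
  -- tolerance up to the end of the block.
  safe : ∀ {P} st → Inv P st → dmg st (target st) ℚ.≤ K · P
  safe     initial                 inv = ·-nonneg K inv
  safe {P} (run cs Z o′ D B x l w) (_ , blk) = ·-cancel N 0<N (begin
    N · D (x ⊕ unit l)                             ≤⟨ ·-mono N (∈⇒≤S D-nonneg here∈) ⟩
    N · S D (path (pos cs) (letter cs) o o′)       ≤⟨ path≤ ⟩
    (2 * c₂ + i * N) · P                           ≤⟨ ·-monoˡ 0≤P (budget (≤-trans (m≤m+n i _) (≤-reflexive elapsed))) ⟩
    (N * K) · P                                    ≡⟨ sym (×-assocˡ P N K) ⟩
    N · K · P                                      ∎)
    where
    open Block blk
    open ℚP.≤-Reasoning
    here∈ : x ⊕ unit l ∈ path (pos cs) (letter cs) o o′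
    here∈ = subst (x ⊕ unit l ∈_) (sym path≡) (∈-++⁺ʳ done (here refl))

  dmg-update : ∀ st m v → dmg (update st m) v ≡ dmg st v ℚ.+ m v
  dmg-update initial                        m v = sym (ℚP.+-identityˡ (m v))
  dmg-update (run cs Z o′ D B x l [])       m v = refl
  dmg-update (run cs Z o′ D B x l (l′ ∷ w)) m v = refl

  pos-update : ∀ st m → pos (update st m) ≡ target st
  pos-update initial                        m = refl
  pos-update (run cs Z o′ D B x l [])       m = refl
  pos-update (run cs Z o′ D B x l (l′ ∷ w)) m = refl

  word≡ : ∀ c o o′ → word c o o′ ≡ c ∷ tailWord c o o′
  word≡ c o o′ = cong (λ j → replicate j c ++ (out o′ ++ back o)) A≡

  start-root : start (0 , 0 , 0) 0ᴼ ≡ (0 , 0 , 0)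
  start-root = triple (cong (_+ 0) (*-zeroʳ R)) lateral lateral
    where
    lateral : A * 0 + suc k * 0 + toℕ (Fin.fromℕ< 0<A) ≡ 0
    lateral = cong₂ _+_ (cong₂ _+_ (*-zeroʳ A) (*-zeroʳ (suc k))) (FinP.toℕ-fromℕ< 0<A)

  S-⊞ : ∀ D m L → S (D ⊞ m) L ≡ S D L ℚ.+ S m L
  S-⊞ D m L = S.∑-⊕ D m L

  grow : ∀ {a b c P : ℚ} {p} i → a ℚ.≤ (p + i * N) · P → b ℚ.≤ N · P → a ℚ.+ b ℚ.≤ (p + suc i * N) · P
  grow {P = P} {p = p} i h h′ = ℚP.≤-trans (ℚP.+-mono-≤ h h′)
    (ℚP.≤-reflexive (trans (sym (×-homo-+ P (p + i * N) N)) (cong (_· P) (arrange p i N))))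
    where
    arrange : ∀ p i N → p + i * N + N ≡ p + (N + i * N)
    arrange = solve-∀

  module _ {P : ℚ} {m : Move} (m-power : Power P m) where
    open Power m-power

    path-increment : ∀ Z c o o′ → N · S m (path Z c o o′) ℚ.≤ N · P
    path-increment Z c o o′ = ·-mono N (ℚP.≤-trans (bound (path Z c o o′) 1 (λ v → occ-walk≤1 v (start Z o) (word c o o′)))
      (ℚP.≤-reflexive (×-homo-1 P)))

    fan-increment : ∀ Z o → S m (fan Z o) ℚ.≤ N · P
    fan-increment Z o = bound (fan Z o) N (λ v → fan-bound v Z o)

    advance-path : ∀ {D p} i Z c o o′ → N · S D (path Z c o o′) ℚ.≤ (p + i * N) · P →
                   N · S (D ⊞ m) (path Z c o o′) ℚ.≤ (p + suc i * N) · P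
    advance-path {D} {p} i Z c o o′ h = ℚP.≤-trans (ℚP.≤-reflexive (trans (cong (N ·_) (S-⊞ D m (path Z c o o′))) (×-distrib-+ _ _ N)))
      (grow {c = P} {p = p} i h (path-increment Z c o o′))

    advance-fan : ∀ {D p} i Z o → S D (fan Z o) ℚ.≤ (p + i * N) · P → S (D ⊞ m) (fan Z o) ℚ.≤ (p + suc i * N) · P
    advance-fan {D} {p} i Z o h = ℚP.≤-trans (ℚP.≤-reflexive (S-⊞ D m (fan Z o))) (grow {c = P} {p = p} i h (fan-increment Z o))

  Power-suc : ∀ {P i B m} → Power (i · P) B → Power P m → Power (suc i · P) (B ⊞ m)
  Power-suc {P} {i} {B} {m} pB pm = subst (λ Q → Power Q (B ⊞ m)) (ℚP.+-comm (i · P) P) (Power-+ pB pm)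

  coarse-⊞ : ∀ {D B m a} z → a ℚ.+ coarse B z ≡ coarse D z → a ℚ.+ coarse (B ⊞ m) z ≡ coarse (D ⊞ m) z
  coarse-⊞ {D} {B} {m} {a} z h = begin
    a ℚ.+ S (B ⊞ m) (region z)                       ≡⟨ cong (a ℚ.+_) (S-⊞ B m (region z)) ⟩
    a ℚ.+ (S B (region z) ℚ.+ S m (region z))        ≡⟨ sym (ℚP.+-assoc a _ _) ⟩
    a ℚ.+ S B (region z) ℚ.+ S m (region z)          ≡⟨ cong (ℚ._+ S m (region z)) h ⟩
    S D (region z) ℚ.+ S m (region z)                ≡⟨ sym (S-⊞ D m (region z)) ⟩
    S (D ⊞ m) (region z)                             ∎
    where open ≡-Reasoning

  coarse-power : ∀ {P B} → Power (R · P) B → Power (coarsePower P) (coarse B)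
  coarse-power {P} {B} p = subst (λ Q → Power Q (coarse B)) (×-assocˡ P (3 * N) R)
    (Power-collect (3 * N) (λ v L h → region-bound v L h) p)

  -- The minimal cost is at most the average one, which the fan of the current block and the coarse damage control.
  newOffset-cost : ∀ {P D} Z c o → (∀ v → 0ℚ ℚ.≤ D v) → S D (fan Z o) ℚ.≤ (c₂ + R * N) · P →
                   coarse D (Z ⊕ unit c) ℚ.≤ K · coarsePower P →
                   cost D Z c o (newOffset D Z c o) ℚ.≤ (2 * c₂) · P
  newOffset-cost {P} {D} Z c o D≥0 fan≤ coarse≤ = ·-cancel N 0<N (begin
    N · cost D Z c o (newOffset D Z c o)
      ≡⟨ cong (λ j → j · cost D Z c o (newOffset D Z c o)) (sym length-offsets) ⟩
    length offsets · cost D Z c o (newOffset D Z c o)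
      ≤⟨ argmin-average (cost D Z c o) 0ᴼ offsets ⟩
    S (cost D Z c o) offsets
      ≡⟨ trans (S.∑-⊕ _ _ offsets) (cong₂ ℚ._+_ (S-· N _ offsets) (S-· 2 _ offsets)) ⟩
    N · S (λ o′ → S D (path Z c o o′)) offsets ℚ.+ 2 · S (λ o′ → S D (fan (Z ⊕ unit c) o′)) offsets
      ≤⟨ ℚP.+-mono-≤ (·-mono N paths≤) (·-mono 2 fans≤) ⟩
    N · (c₂ + R * N) · P ℚ.+ 2 · K · coarsePower P
      ≡⟨ cong₂ ℚ._+_ (×-assocˡ P N (c₂ + R * N)) (trans (cong (2 ·_) (×-assocˡ P K (3 * N * R))) (×-assocˡ P 2 (K * (3 * N * R)))) ⟩
    (N * (c₂ + R * N)) · P ℚ.+ (2 * (K * (3 * N * R))) · P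
      ≡⟨ sym (×-homo-+ P (N * (c₂ + R * N)) (2 * (K * (3 * N * R)))) ⟩
    (N * (c₂ + R * N) + 2 * (K * (3 * N * R))) · P
      ≡⟨ cong (_· P) (arrange N R K) ⟩
    (N * (2 * c₂)) · P
      ≡⟨ sym (×-assocˡ P N _) ⟩
    N · (2 * c₂) · P ∎)
    where
    open ℚP.≤-Reasoning
    arrange : ∀ N R K → N * (6 * (R * K) + R * N + R * N) + 2 * (K * (3 * N * R)) ≡ N * (2 * (6 * (R * K) + R * N))
    arrange = solve-∀
    c∈letters : ∀ c → c ∈ letters
    c∈letters 0F = here refl
    c∈letters 1F = there (here refl)
    c∈letters 2F = there (there (here refl))
    paths≤ : S (λ o′ → S D (path Z c o o′)) offsets ℚ.≤ (c₂ + R * N) · P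
    paths≤ = begin
      S (λ o′ → S D (path Z c o o′)) offsets
        ≤⟨ S-mono offsets (λ o′ → ∈⇒≤S {f = λ c → S D (path Z c o o′)} (λ c → S-nonneg (path Z c o o′) D≥0) (c∈letters c)) ⟩
      S (λ o′ → S (λ c → S D (path Z c o o′)) letters) offsets
        ≡⟨ sym (trans (S.∑-concatMap D (λ o′ → concatMap (λ c → path Z c o o′) letters) offsets)
             (S.∑-cong offsets (λ o′ → S.∑-concatMap D (λ c → path Z c o o′) letters))) ⟩
      S D (fan Z o)
        ≤⟨ fan≤ ⟩
      (c₂ + R * N) · P ∎
    fans≤ : S (λ o′ → S D (fan (Z ⊕ unit c) o′)) offsets ℚ.≤ K · coarsePower P
    fans≤ = ℚP.≤-trans (ℚP.≤-reflexive (sym (S.∑-concatMap D (fan (Z ⊕ unit c)) offsets))) coarse≤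

  newBlock-Inv : ∀ {P cs Z o D x} → 0ℚ ℚ.≤ P → Inv (coarsePower P) cs → pos cs ≡ Z → x ≡ start Z o → (∀ v → 0ℚ ℚ.≤ D v) →
                 (∀ z → dmg cs z ≡ coarse D z) → S D (fan Z o) ℚ.≤ (c₂ + R * N) · P → Inv P (newBlock cs Z o D x)
  newBlock-Inv {P} {cs} {_} {o} {D} 0≤P inv refl refl D≥0 D-coarse fan≤ = inv , record
    { 0≤P      = 0≤P
    ; i        = 0
    ; elapsed  = trans (cong length (sym (word≡ c o o′))) (length-word c o o′)
    ; Z≡       = refl
    ; o        = o
    ; done     = []
    ; path≡    = cong (walk (start Z o)) (word≡ c o o′)
    ; end≡     = trans (cong (λ w → start Z o ⊕ disp w) (sym (word≡ c o o′))) (path-end Z c o o′)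
    ; D-nonneg = D≥0
    ; B-power  = Power-0
    ; D-coarse = λ z → trans (cong (dmg cs z ℚ.+_) (S-zero (region z))) (trans (ℚP.+-identityʳ _) (D-coarse z))
    ; path≤    = ℚP.≤-trans (x≤x+y (·-nonneg 2 (S-nonneg (fan (Z ⊕ unit c) o′) D≥0))) (widen (2 * c₂) cost≤)
    ; fan≤     = widen c₂ (·-cancel 2 (s≤s z≤n) (ℚP.≤-trans (y≤x+y (·-nonneg N (S-nonneg (path Z c o o′) D≥0)))
                   (ℚP.≤-trans cost≤ (ℚP.≤-reflexive (sym (×-assocˡ P 2 c₂))))))
    }
    where
    Z  = pos cs
    c  = letter cs
    o′ = newOffset D Z c o
    cost≤ : cost D Z c o o′ ℚ.≤ (2 * c₂) · P
    -- Self-similarity enters here: `safe` for the coarse play bounds the damage of its next target,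
    -- which is the total damage of all fans at the end of the new block.
    cost≤ = newOffset-cost Z c o D≥0 fan≤ (ℚP.≤-trans (ℚP.≤-reflexive (sym (D-coarse (Z ⊕ unit c)))) (safe cs inv))
    widen : ∀ p {a} → a ℚ.≤ p · P → a ℚ.≤ (p + 0) · P
    widen p = subst (λ q → _ ℚ.≤ q · P) (sym (+-identityʳ p))

  update-Inv : ∀ {P} st {m} → Inv P st → Power P m → Inv P (update st m)
  update-Inv {P} initial {m} 0≤P p = ·-nonneg (3 * N * R) 0≤P , record
    { 0≤P      = 0≤P
    ; i        = 1
    ; elapsed  = trans (cong length (sym (word≡ 0F 0ᴼ 0ᴼ))) (length-word 0F 0ᴼ 0ᴼ)
    ; Z≡       = refl
    ; o        = 0ᴼ
    ; done     = unit 0F ∷ []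
    ; path≡    = cong₂ walk start-root (word≡ 0F 0ᴼ 0ᴼ)
    ; end≡     = trans (cong₂ (λ s w → s ⊕ disp w) (sym start-root) (sym (word≡ 0F 0ᴼ 0ᴼ))) (path-end (0 , 0 , 0) 0F 0ᴼ 0ᴼ)
    ; D-nonneg = Power.nonneg p
    ; B-power  = subst (λ Q → Power Q m) (sym (×-homo-1 P)) p
    ; D-coarse = λ z → ℚP.+-identityˡ _
    ; path≤    = ℚP.≤-trans (path-increment p (0 , 0 , 0) 0F 0ᴼ 0ᴼ) (·-monoˡ 0≤P (≤-trans (≤-reflexive (sym (*-identityˡ N))) (m≤n+m (1 * N) (2 * c₂))))
    ; fan≤     = ℚP.≤-trans (fan-increment p (unit 0F) 0ᴼ) (·-monoˡ 0≤P (≤-trans (≤-reflexive (sym (*-identityˡ N))) (m≤n+m (1 * N) c₂)))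
    }
  update-Inv {P} (run cs Z o′ D B x l (l′ ∷ w)) {m} (inv , blk) p = inv , record
    { 0≤P      = 0≤P
    ; i        = suc i
    ; elapsed  = trans (sym (+-suc i _)) elapsed
    ; Z≡       = Z≡
    ; o        = o
    ; done     = done ++ x ⊕ unit l ∷ []
    ; path≡    = trans path≡ (sym (ListP.++-assoc done (x ⊕ unit l ∷ []) _))
    ; end≡     = trans (⊕-assoc x (unit l) (disp (l′ ∷ w))) end≡
    ; D-nonneg = λ v → ℚP.+-mono-≤ (D-nonneg v) (Power.nonneg p v)
    ; B-power  = Power-suc {i = i} B-power p
    ; D-coarse = λ z → coarse-⊞ {D} {B} {m} {dmg cs z} z (D-coarse z)
    ; path≤    = advance-path p {D} {2 * c₂} i (pos cs) (letter cs) o o′ path≤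
    ; fan≤     = advance-fan p {D} {c₂} i Z o′ fan≤
    }
    where open Block blk
  update-Inv {P} (run cs Z o′ D B x l []) {m} (inv , blk) p =
    -- The move of the coarse Devil comprises all `R` replies of the finished block, the present `m`
    -- included.
    newBlock-Inv 0≤P (update-Inv cs inv (coarse-power (subst (λ j → Power (j · P) (B ⊞ m)) i+1≡R (Power-suc {i = i} B-power p))))
      (trans (pos-update cs _) (sym Z≡))
      (trans (cong (x ⊕_) (sym (⊕-identityʳ (unit l)))) end≡)
      (λ v → ℚP.+-mono-≤ (D-nonneg v) (Power.nonneg p v))
      (λ z → trans (dmg-update cs _ z) (coarse-⊞ {D} {B} {m} {dmg cs z} z (D-coarse z)))
      (subst (λ j → S (D ⊞ m) (fan Z o′) ℚ.≤ (c₂ + j * N) · P) i+1≡R (advance-fan p {D} {c₂} i Z o′ fan≤))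
    where
    open Block blk
    i+1≡R : suc i ≡ R
    i+1≡R = trans (+-comm 1 i) elapsed

record Strategy (K : ℕ) : Set₁ where
  field
    State   : Set
    initial : State
    letter  : State → Letter
    pos     : State → V
    dmg     : State → V → ℚ
    update  : State → (V → ℚ) → State
    Inv     : ℚ → State → Set

  target : State → V
  target st = pos st ⊕ unit (letter st)

  field
    pos-initial : pos initial ≡ (0 , 0 , 0)
    dmg-initial : ∀ v → dmg initial v ≡ 0ℚ
    Inv-initial : ∀ {P} → 0ℚ ℚ.≤ P → Inv P initial
    pos-update  : ∀ st m → pos (update st m) ≡ target st
    dmg-update  : ∀ st m v → dmg (update st m) v ≡ dmg st v ℚ.+ m v
    safe        : ∀ {P} st → Inv P st → dmg st (target st) ℚ.≤ K · P
    update-Inv  : ∀ {P} st {m} → Inv P st → Power P m → Inv P (update st m)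

-- 3576 = 6 · 596 with blocks of 596 = 120 + 4 · 119 moves between 120 · 120 ≥ 24 · 596 offsets.
strategy : Strategy 3576
strategy = record
  { State = St ; initial = initial ; letter = letter ; pos = pos ; dmg = dmg ; update = update ; Inv = Inv
  ; pos-initial = refl ; dmg-initial = λ _ → refl ; Inv-initial = λ 0≤P → 0≤P
  ; pos-update = pos-update ; dmg-update = dmg-update ; safe = safe ; update-Inv = λ st → update-Inv st }
  where open Hierarchy 118 120 596 3576 refl refl refl (ℕP.≤ᵇ⇒≤ (24 * 596) (120 * 120) _)

-- Random walks guided by a plan

open Occurrences (FinP._≟_ {3}) using () renaming (occ to count)

0<⇒∈-occ : {A : Set} (_≟_ : DecidableEquality A) {x : A} {xs : List A} → x ∈ xs → 0 < Occurrences.occ _≟_ x xs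
0<⇒∈-occ _≟_ {x} {y ∷ ys} (here refl) = ≤-trans (≤-reflexive (sym (𝟙-yes (x ≟ x) refl))) (m≤m+n _ _)
0<⇒∈-occ _≟_ {x} {y ∷ ys} (there x∈) = ≤-trans (0<⇒∈-occ _≟_ x∈) (m≤n+m _ (𝟙 (x ≟ y)))

count-++ : ∀ g u w → count g (u ++ w) ≡ count g u + count g w
count-++ g u w = ∑-++ _ u w

disp-count : ∀ w → disp w ≡ (count 0F w + count 1F w + count 2F w , count 1F w , count 2F w)
disp-count []       = refl
disp-count (0F ∷ w) = cong (unit 0F ⊕_) (disp-count w)
disp-count (1F ∷ w) = trans (cong (unit 1F ⊕_) (disp-count w)) (triple (arrange (count 0F w) _ _) refl refl)
  where
  arrange : ∀ a b c → 1 + (a + b + c) ≡ a + (1 + b) + c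
  arrange = solve-∀
disp-count (2F ∷ w) = trans (cong (unit 2F ⊕_) (disp-count w)) (triple (arrange (count 0F w + count 1F w) _) refl refl)
  where
  arrange : ∀ a c → 1 + (a + c) ≡ a + (1 + c)
  arrange = solve-∀

-- Bounds the number of walks along `w` between two given vertices: `w` prescribes when each group
-- moves, and the end vertex prescribes the multiset of moves within each group, so only their order
-- is free.
orders : List Letter → ℕ
orders w = count 0F w ! * (count 1F w ! * count 2F w !)

orders-∷ : ∀ g w → orders (g ∷ w) ≡ count g (g ∷ w) * orders w
orders-∷ 0F w = *-assoc (suc (count 0F w)) (count 0F w !) _
orders-∷ 1F w = arrange (count 0F w !) (suc (count 1F w)) (count 1F w !) (count 2F w !)
  where
  arrange : ∀ a k b c → a * (k * b * c) ≡ k * (a * (b * c))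
  arrange = solve-∀
orders-∷ 2F w = arrange (count 0F w !) (count 1F w !) (suc (count 2F w)) (count 2F w !)
  where
  arrange : ∀ a b k c → a * (b * (k * c)) ≡ k * (a * (b * c))
  arrange = solve-∀

module Groups (a b : ℕ) where

  size : ℕ
  size = 3 * a * b

  index : Letter → Fin a × Fin b → Fin size
  index g (k , l) = combine (combine {3} {a} g k) l

  group : Fin size → Letter
  group i = proj₁ (remQuot {3} a (proj₁ (remQuot {3 * a} b i)))

  group-index : ∀ g p → group (index g p) ≡ g
  group-index g (k , l) = trans (cong (λ q → proj₁ (remQuot {3} a (proj₁ q))) (FinP.remQuot-combine {3 * a} (combine {3} {a} g k) l))
    (cong proj₁ (FinP.remQuot-combine {3} g k))

  index-injective : ∀ g {p q} → index g p ≡ index g q → p ≡ q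
  index-injective g {k , l} {k′ , l′} eq
    with e , refl ← FinP.combine-injective {3 * a} (combine {3} {a} g k) l (combine {3} {a} g k′) l′ eq
    with _ , refl ← FinP.combine-injective {3} g k g k′ e = refl

  members : Letter → List (Fin size)
  members g = map (index g) (cartesianProduct (allFin a) (allFin b))

  length-members : ∀ g → length (members g) ≡ a * b
  length-members g = trans (ListP.length-map (index g) (cartesianProduct (allFin a) (allFin b)))
    (trans (length-cartesianProduct (allFin a) (allFin b))
      (cong₂ _*_ (ListP.length-tabulate {n = a} (λ i → i)) (ListP.length-tabulate {n = b} (λ i → i))))

  ∈-members⇒group : ∀ {g i} → i ∈ members g → group i ≡ g
  ∈-members⇒group {g} i∈ with p , _ , refl ← ∈-map⁻ (index g) i∈ = group-index g p

  occ-members : ∀ {g i} h → i ∈ members g → Occurrences.occ FinP._≟_ i (members h) ≡ 𝟙 (h FinP.≟ g)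
  occ-members {g} {i} h i∈ with h FinP.≟ g
  ... | yes refl = ≤-antisym
    (occ-Unique FinP._≟_ (UniqueP.map⁺ (index-injective g) (UniqueP.cartesianProduct⁺ (UniqueP.allFin⁺ a) (UniqueP.allFin⁺ b))) i)
    (0<⇒∈-occ FinP._≟_ i∈)
  ... | no h≢g with ≡0-or-0< (Occurrences.occ FinP._≟_ i (members h))
  ...   | inj₁ e = e
  ...   | inj₂ p = ⊥-elim (h≢g (trans (sym (∈-members⇒group (Occurrences.0<occ⇒∈ FinP._≟_ (members h) p))) (∈-members⇒group i∈)))

module Weights (n M : ℕ) (members : Letter → List (Fin n))
             (occ-members : ∀ {g i} h → i ∈ members g → Occurrences.occ FinP._≟_ i (members h) ≡ 𝟙 (h FinP.≟ g)) where

  X : Set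
  X = Vertex n

  _≟_ : DecidableEquality X
  _≟_ = VecP.≡-dec ℕ._≟_

  sumOver : Letter → X → ℕ
  sumOver g x = ∑ (lookup x) (members g)

  quot : X → V
  quot x = (sumOver 0F x + sumOver 1F x + sumOver 2F x , sumOver 1F x , sumOver 2F x)

  lookup-step : ∀ (x : X) i j → lookup (step x i) j ≡ lookup x j + 𝟙 (i FinP.≟ j)
  lookup-step x i j with i FinP.≟ j
  ... | yes refl = trans (VecP.lookup∘updateAt i x) (+-comm 1 _)
  ... | no i≢j   = trans (VecP.lookup∘updateAt′ j i (i≢j ∘ sym) x) (sym (+-identityʳ _))

  sumOver-step : ∀ {g i} (x : X) h → i ∈ members g → sumOver h (step x i) ≡ sumOver h x + 𝟙 (h FinP.≟ g)
  sumOver-step {g} {i} x h i∈ = trans (∑-cong (members h) (lookup-step x i))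
    (trans (∑-⊕ (lookup x) (λ j → 𝟙 (i FinP.≟ j)) (members h)) (cong (sumOver h x +_) (occ-members h i∈)))

  quot-counts : ∀ {x v w} → (∀ g → sumOver g v ≡ sumOver g x + count g w) → quot v ≡ quot x ⊕ disp w
  quot-counts {x} {v} {w} h = begin
    quot v ≡⟨ triple (cong₂ _+_ (cong₂ _+_ (h 0F) (h 1F)) (h 2F)) (h 1F) (h 2F) ⟩
    _      ≡⟨ triple (arrange (sumOver 0F x) (count 0F w) (sumOver 1F x) (count 1F w) (sumOver 2F x) (count 2F w)) refl refl ⟩
    quot x ⊕ (count 0F w + count 1F w + count 2F w , count 1F w , count 2F w) ≡⟨ cong (quot x ⊕_) (sym (disp-count w)) ⟩
    quot x ⊕ disp w ∎
    where
    open ≡-Reasoning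
    arrange : ∀ a d b e c f → a + d + (b + e) + (c + f) ≡ a + b + c + (d + e + f)
    arrange = solve-∀

  quot-step : ∀ {g i} (x : X) → i ∈ members g → quot (step x i) ≡ quot x ⊕ unit g
  quot-step {g} {i} x i∈ = trans (quot-counts {x} {step x i} {g ∷ []} λ h → trans (sumOver-step x h i∈) (cong (sumOver h x +_) (sym (+-identityʳ _))))
    (cong (quot x ⊕_) (⊕-identityʳ (unit g)))

  cnt : X → List Letter → X → ℕ
  cnt x []      v = 𝟙 (x ≟ v)
  cnt x (g ∷ w) v = ∑ (λ i → cnt (step x i) w v) (members g)

  cnt-support : ∀ x w v → 0 < cnt x w v →
                (∀ j → lookup x j ≤ lookup v j) × (∀ g → sumOver g v ≡ sumOver g x + count g w)
  cnt-support x []      v p with refl ← 0<𝟙⇒ {d = x ≟ v} p = (λ j → ≤-refl) , (λ g → sym (+-identityʳ _))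
  cnt-support x (g ∷ w) v p with i , i∈ , q ← 0<∑⇒∃ _ (members g) p with x≤v , sums ← cnt-support (step x i) w v q =
    (λ j → ≤-trans (≤-trans (m≤m+n (lookup x j) _) (≤-reflexive (sym (lookup-step x i j)))) (x≤v j)) ,
    (λ h → trans (sums h) (trans (cong (_+ count h w) (sumOver-step x h i∈)) (+-assoc (sumOver h x) _ _)))

  free : X → X → Fin n → ℕ
  free x v i = 𝟙 (lookup x i ℕ.<? lookup v i)

  free-bound : ∀ {k} x v xs → (∀ j → lookup x j ≤ lookup v j) → ∑ (lookup v) xs ≡ ∑ (lookup x) xs + k → ∑ (free x v) xs ≤ k
  free-bound {k} x v xs x≤v eq = +-cancelˡ-≤ (∑ (lookup x) xs) _ _ (begin
    ∑ (lookup x) xs + ∑ (free x v) xs       ≡⟨ sym (∑-⊕ (lookup x) (free x v) xs) ⟩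
    ∑ (λ j → lookup x j + free x v j) xs    ≤⟨ ∑-mono xs pointwise ⟩
    ∑ (lookup v) xs                         ≡⟨ eq ⟩
    ∑ (lookup x) xs + k                     ∎)
    where
    open ≤-Reasoning
    pointwise : ∀ j → lookup x j + free x v j ≤ lookup v j
    pointwise j with lookup x j ℕ.<? lookup v j
    ... | yes x<v = ≤-trans (≤-reflexive (+-comm (lookup x j) 1)) x<v
    ... | no _    = ≤-trans (≤-reflexive (+-identityʳ _)) (x≤v j)

  ∑-*ʳ : {A : Set} (f : A → ℕ) (c : ℕ) (xs : List A) → ∑ (λ x → f x * c) xs ≡ ∑ f xs * c
  ∑-*ʳ f c []       = refl
  ∑-*ʳ f c (x ∷ xs) = trans (cong (f x * c +_) (∑-*ʳ f c xs)) (sym (*-distribʳ-+ c (f x) _))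

  -- The first move must use a coordinate still below that of `v`. By `free-bound` the group offers
  -- at most `count g (g ∷ w)` of these, and `orders` obeys the same recursion.
  cnt≤orders : ∀ x w v → cnt x w v ≤ orders w
  cnt≤orders x []      v = 𝟙≤1 (x ≟ v)
  cnt≤orders x (g ∷ w) v with ≡0-or-0< (cnt x (g ∷ w) v)
  ... | inj₁ e = ≤-trans (≤-reflexive e) z≤n
  ... | inj₂ p = begin
    ∑ (λ i → cnt (step x i) w v) (members g)        ≤⟨ ∑-mono (members g) pointwise ⟩
    ∑ (λ i → free x v i * orders w) (members g)     ≡⟨ ∑-*ʳ (free x v) (orders w) (members g) ⟩
    ∑ (free x v) (members g) * orders w             ≤⟨ *-monoˡ-≤ (orders w) (free-bound x v (members g) (proj₁ support) (proj₂ support g)) ⟩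
    count g (g ∷ w) * orders w                      ≡⟨ sym (orders-∷ g w) ⟩
    orders (g ∷ w)                                  ∎
    where
    open ≤-Reasoning
    support = cnt-support x (g ∷ w) v p
    pointwise : ∀ i → cnt (step x i) w v ≤ free x v i * orders w
    pointwise i with lookup x i ℕ.<? lookup v i
    ... | yes _  = ≤-trans (cnt≤orders (step x i) w v) (≤-reflexive (sym (*-identityˡ _)))
    ... | no x≮v with ≡0-or-0< (cnt (step x i) w v)
    ...   | inj₁ e = ≤-reflexive e
    ...   | inj₂ q = ⊥-elim (x≮v (subst (_≤ lookup v i) (VecP.lookup∘updateAt i x) (proj₁ (cnt-support (step x i) w v q) i)))

  cnt-bound : ∀ x w v → cnt x w v ≤ orders w * 𝟙 (quot v ≟ⱽ (quot x ⊕ disp w))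
  cnt-bound x w v with ≡0-or-0< (cnt x w v)
  ... | inj₁ e = ≤-trans (≤-reflexive e) z≤n
  ... | inj₂ p = ≤-trans (cnt≤orders x w v) (≤-reflexive (sym (trans
    (cong (orders w *_) (𝟙-yes (quot v ≟ⱽ (quot x ⊕ disp w)) (quot-counts {x} {v} {w} (proj₂ (cnt-support x w v p))))) (*-identityʳ _))))

  -- The part of the potential due to the letters of `w` after the prefix `u`. The exponents count
  -- the letters still to come, which clears the denominators.
  tailψ : X → List Letter → List Letter → X → ℕ
  tailψ x u []      v = 0
  tailψ x u (g ∷ w) v = M ^ length w * cnt x (u ++ g ∷ []) v + tailψ x (u ++ g ∷ []) w v

  -- Up to the factor M ^ length w, the weight (4/3)^j Pr(v is the j-th vertex of a uniformly random walk from x along w).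
  ψ : X → List Letter → X → ℕ
  ψ x = tailψ x []

  ∑-*ˡ : {A : Set} (c : ℕ) (f : A → ℕ) (xs : List A) → ∑ (λ x → c * f x) xs ≡ c * ∑ f xs
  ∑-*ˡ c f xs = trans (∑-cong xs λ x → *-comm c (f x)) (trans (∑-*ʳ f c xs) (*-comm _ c))

  tailψ-∷ : ∀ x g u w v → tailψ x (g ∷ u) w v ≡ ∑ (λ i → tailψ (step x i) u w v) (members g)
  tailψ-∷ x g u []      v = sym (∑-ε (members g))
  tailψ-∷ x g u (h ∷ w) v = trans
    (cong₂ _+_ (sym (∑-*ˡ (M ^ length w) (λ i → cnt (step x i) (u ++ h ∷ []) v) (members g))) (tailψ-∷ x g (u ++ h ∷ []) w v))
    (sym (∑-⊕ _ (λ i → tailψ (step x i) (u ++ h ∷ []) w v) (members g)))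

  ψ-∷ : ∀ x g w v → ψ x (g ∷ w) v ≡ ∑ (λ i → M ^ length w * 𝟙 (step x i ≟ v) + ψ (step x i) w v) (members g)
  ψ-∷ x g w v = trans
    (cong₂ _+_ (sym (∑-*ˡ (M ^ length w) (λ i → 𝟙 (step x i ≟ v)) (members g))) (tailψ-∷ x g [] w v))
    (sym (∑-⊕ _ (λ i → tailψ (step x i) [] w v) (members g)))

  -- Extending the plan by `r` rescales the old potential and adds the weights of the new vertices
  -- only.
  tailψ-++ : ∀ x u w r v → tailψ x u (w ++ r) v ≡ M ^ length r * tailψ x u w v + tailψ x (u ++ w) r v
  tailψ-++ x u []      r v = cong₂ _+_ (sym (*-zeroʳ (M ^ length r))) (cong (λ u → tailψ x u r v) (sym (ListP.++-identityʳ u)))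
  tailψ-++ x u (g ∷ w) r v = begin
    M ^ length (w ++ r) * c + tailψ x u′ (w ++ r) v
      ≡⟨ cong₂ _+_ (cong (λ k → M ^ k * c) (ListP.length-++ w)) (tailψ-++ x u′ w r v) ⟩
    M ^ (length w + length r) * c + (M ^ length r * tailψ x u′ w v + tailψ x (u′ ++ w) r v)
      ≡⟨ cong (λ m → m * c + (M ^ length r * tailψ x u′ w v + tailψ x (u′ ++ w) r v)) (^-distribˡ-+-* M (length w) (length r)) ⟩
    M ^ length w * M ^ length r * c + (M ^ length r * tailψ x u′ w v + tailψ x (u′ ++ w) r v)
      ≡⟨ arrange (M ^ length w) (M ^ length r) c _ _ ⟩
    M ^ length r * (M ^ length w * c + tailψ x u′ w v) + tailψ x (u′ ++ w) r v
      ≡⟨ cong (λ u → M ^ length r * (M ^ length w * c + tailψ x u′ w v) + tailψ x u r v) (ListP.++-assoc u (g ∷ []) w) ⟩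
    M ^ length r * tailψ x u (g ∷ w) v + tailψ x (u ++ g ∷ w) r v ∎
    where
    open ≡-Reasoning
    u′ = u ++ g ∷ []
    c  = cnt x u′ v
    arrange : ∀ a m c t s → a * m * c + (m * t + s) ≡ m * (a * c + t) + s
    arrange = solve-∀

  -- A walk along a prefix ends above the corresponding vertex of the walk of group counts, and at
  -- most `orders` such walks end in `v`. A bound `C` that is uniform over the prefixes thus
  -- transfers the potential to the group counts.
  tailψ-bound : ∀ a C x u w v → (∀ g p s → w ≡ g ∷ p ++ s → a * (M ^ length s * orders (u ++ g ∷ p)) ≤ C) →
                a * tailψ x u w v ≤ C * occ (quot v) (walk (quot x ⊕ disp u) w)
  tailψ-bound a C x u []      v h = ≤-trans (≤-reflexive (*-zeroʳ a)) z≤n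
  tailψ-bound a C x u (g ∷ w) v h = begin
    a * (M ^ length w * cnt x u′ v + tailψ x u′ w v)
      ≡⟨ *-distribˡ-+ a (M ^ length w * cnt x u′ v) (tailψ x u′ w v) ⟩
    a * (M ^ length w * cnt x u′ v) + a * tailψ x u′ w v
      ≤⟨ +-mono-≤ (*-monoʳ-≤ a (*-monoʳ-≤ (M ^ length w) (cnt-bound x u′ v)))
           (tailψ-bound a C x u′ w v (λ h′ p s eq → subst (λ z → a * (M ^ length s * orders z) ≤ C) (sym (ListP.++-assoc u (g ∷ []) (h′ ∷ p)))
             (h g (h′ ∷ p) s (cong (g ∷_) eq)))) ⟩
    a * (M ^ length w * (orders u′ * hit)) + C * occ (quot v) (walk (quot x ⊕ disp u′) w)
      ≡⟨ cong (_+ C * occ (quot v) (walk (quot x ⊕ disp u′) w)) (arrange a (M ^ length w) (orders u′) hit) ⟩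
    a * (M ^ length w * orders u′) * hit + C * occ (quot v) (walk (quot x ⊕ disp u′) w)
      ≤⟨ +-monoˡ-≤ (C * occ (quot v) (walk (quot x ⊕ disp u′) w)) (*-monoˡ-≤ hit (h g [] w refl)) ⟩
    C * hit + C * occ (quot v) (walk (quot x ⊕ disp u′) w)
      ≡⟨ sym (*-distribˡ-+ C hit _) ⟩
    C * (hit + occ (quot v) (walk (quot x ⊕ disp u′) w))
      ≡⟨ cong (λ y → C * (𝟙 (quot v ≟ⱽ y) + occ (quot v) (walk y w))) end ⟩
    C * occ (quot v) (walk (quot x ⊕ disp u) (g ∷ w)) ∎
    where
    open ≤-Reasoning
    u′  = u ++ g ∷ []
    hit = 𝟙 (quot v ≟ⱽ (quot x ⊕ disp u′))
    end : quot x ⊕ disp u′ ≡ quot x ⊕ disp u ⊕ unit g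
    end = trans (cong (quot x ⊕_) (trans (disp-++ u (g ∷ [])) (cong (disp u ⊕_) (⊕-identityʳ (unit g))))) (sym (⊕-assoc (quot x) (disp u) (unit g)))
    arrange : ∀ a m o h → a * (m * (o * h)) ≡ a * (m * o) * h
    arrange = solve-∀

-- Rounds and the numerical estimates

round : Letter → List Letter
round c = c ∷ 0F ∷ 1F ∷ 2F ∷ []

rounds : List Letter → List Letter
rounds = concatMap round

-- The three fixed letters keep the groups balanced: no group moves more than twice in a round, so
-- the factorials in `orders` remain small.
count-rounds : ∀ g cs → count g (rounds cs) ≤ length cs * 2
count-rounds g cs = ≤-trans (≤-reflexive (∑-concatMap _ round cs)) (∑-≤-length cs (count-round g))
  where
  count-round : ∀ g c → count g (round c) ≤ 2
  count-round 0F 0F = ≤-refl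
  count-round 0F 1F = s≤s z≤n
  count-round 0F 2F = s≤s z≤n
  count-round 1F 0F = s≤s z≤n
  count-round 1F 1F = ≤-refl
  count-round 1F 2F = s≤s z≤n
  count-round 2F 0F = s≤s z≤n
  count-round 2F 1F = s≤s z≤n
  count-round 2F 2F = ≤-refl

-- Decided by evaluation; 10 is the largest count in five rounds. At 0 the truncated subtraction
-- gives the exponent 0.
!≤6^ : ∀ k → k ≤ 10 → k ! ≤ 6 ^ (k ∸ 1)
!≤6^ k k≤10 = subst (λ k → k ! ≤ 6 ^ (k ∸ 1)) (FinP.toℕ-fromℕ< (s≤s k≤10))
  (toWitness {a? = FinP.all? {11} (λ i → Fin.toℕ i ! ℕ.≤? 6 ^ (Fin.toℕ i ∸ 1))} _ (Fin.fromℕ< (s≤s k≤10)))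

-- The factor 6 saved in the exponent is what limits the effect of Devil's reply to 1/6 in
-- `ψ-increment`.
orders≤6^ : ∀ w → (∀ g → count g w ≤ 10) → orders w ≤ 6 ^ (length w ∸ 1)
orders≤6^ w few = begin
  orders w
    ≤⟨ *-mono-≤ (!≤6^ k₀ (few 0F)) (*-mono-≤ (!≤6^ k₁ (few 1F)) (!≤6^ k₂ (few 2F))) ⟩
  6 ^ (k₀ ∸ 1) * (6 ^ (k₁ ∸ 1) * 6 ^ (k₂ ∸ 1))
    ≡⟨ trans (cong (6 ^ (k₀ ∸ 1) *_) (sym (^-distribˡ-+-* 6 (k₁ ∸ 1) (k₂ ∸ 1)))) (sym (^-distribˡ-+-* 6 (k₀ ∸ 1) _)) ⟩
  6 ^ (k₀ ∸ 1 + (k₁ ∸ 1 + (k₂ ∸ 1)))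
    ≤⟨ ^-monoʳ-≤ 6 (≤-trans (exponents k₀ k₁ k₂) (≤-reflexive (cong (_∸ 1) (sym size)))) ⟩
  6 ^ (length w ∸ 1) ∎
  where
  open ≤-Reasoning
  k₀ = count 0F w
  k₁ = count 1F w
  k₂ = count 2F w
  size : length w ≡ k₀ + k₁ + k₂
  size = trans (sym (level-disp w)) (cong level (disp-count w))
  exponents : ∀ a b c → a ∸ 1 + (b ∸ 1 + (c ∸ 1)) ≤ a + b + c ∸ 1
  exponents (suc a) b c = ≤-trans (+-monoʳ-≤ a (+-mono-≤ (m∸n≤m b 1) (m∸n≤m c 1))) (≤-reflexive (sym (+-assoc a b c)))
  exponents zero (suc b) c = +-monoʳ-≤ b (m∸n≤m c 1)
  exponents zero zero    c = ≤-refl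

-- The large constants come last: as first factors they would be unfolded in conversion checking.
Within : List Letter → Set
Within w = orders w * (192 * 3576) ≤ 6 ^ length w * 19

-- Decided by evaluating all 3^5 · 5 cases. The factor 192 is 48 · 4, since potentials are measured
-- in units of 1/48 and Devil moves four times in a round; 3576 is the tolerance, and 19 the share
-- of the potential reserved for a new round.
entryBound : ∀ c₁ c₂ c₃ c₄ c (j : Fin 5) → Within (take (16 + Fin.toℕ j) (rounds (c₁ ∷ c₂ ∷ c₃ ∷ c₄ ∷ c ∷ [])))
entryBound = toWitness {a? = FinP.all? λ c₁ → FinP.all? λ c₂ → FinP.all? λ c₃ → FinP.all? λ c₄ → FinP.all? λ c → FinP.all? {5} λ j → _ ℕ.≤? _} _

-- Finite measures as weighted lists

Measure : Set → Set
Measure A = List (A × ℚ)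

∫ : {A : Set} → (A → ℕ) → Measure A → ℚ
∫ h = S (λ e → h (proj₁ e) · proj₂ e)

Nonneg : {A : Set} → Measure A → Set
Nonneg = All (λ e → 0ℚ ℚ.≤ proj₂ e)

mass : {A : Set} → Measure A → ℚ
mass = S proj₂

module _ {A : Set} where

  ∫-mono : (h h′ : A → ℕ) {μ : Measure A} → Nonneg μ → (∀ v → h v ≤ h′ v) → ∫ h μ ℚ.≤ ∫ h′ μ
  ∫-mono h h′ []        le = ℚP.≤-refl
  ∫-mono h h′ {(v , _) ∷ _} (0≤a ∷ p) le = ℚP.+-mono-≤ (·-monoˡ 0≤a (le v)) (∫-mono h h′ p le)

  ∫-cong : {h h′ : A → ℕ} (μ : Measure A) → (∀ v → h v ≡ h′ v) → ∫ h μ ≡ ∫ h′ μ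
  ∫-cong μ e = S.∑-cong μ (λ { (v , a) → cong (_· a) (e v) })

  ∫-+ : (h h′ : A → ℕ) (μ : Measure A) → ∫ (λ v → h v + h′ v) μ ≡ ∫ h μ ℚ.+ ∫ h′ μ
  ∫-+ h h′ μ = trans (S.∑-cong μ (λ { (v , a) → ×-homo-+ a (h v) (h′ v) })) (S.∑-⊕ _ _ μ)

  ∫-* : (k : ℕ) (h : A → ℕ) (μ : Measure A) → ∫ (λ v → k * h v) μ ≡ k · ∫ h μ
  ∫-* k h μ = trans (S.∑-cong μ (λ { (v , a) → sym (×-assocˡ a k (h v)) })) (S-· k _ μ)

  ∫-∑ : {B : Set} (h : B → A → ℕ) (xs : List B) (μ : Measure A) → ∫ (λ v → ∑ (λ i → h i v) xs) μ ≡ S (λ i → ∫ (h i) μ) xs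
  ∫-∑ h []       μ = S.∑-ε μ
  ∫-∑ h (x ∷ xs) μ = trans (∫-+ (h x) _ μ) (cong (∫ (h x) μ ℚ.+_) (∫-∑ h xs μ))

  ∫-nonneg : (h : A → ℕ) {μ : Measure A} → Nonneg μ → 0ℚ ℚ.≤ ∫ h μ
  ∫-nonneg h []                    = ℚP.≤-refl
  ∫-nonneg h {(v , _) ∷ _} (0≤a ∷ p) = ℚP.+-mono-≤ (·-nonneg (h v) 0≤a) (∫-nonneg h p)

  ∫-bound : (h : A → ℕ) {c : ℕ} {μ : Measure A} → Nonneg μ → (∀ v → h v ≤ c) → ∫ h μ ℚ.≤ c · mass μ
  ∫-bound h {c} {μ} p le = ℚP.≤-trans (∫-mono h (λ _ → c) p le) (ℚP.≤-reflexive (S-· c proj₂ μ))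

-- A round consists of the letter chosen by the play and of one move in each group.  The play runs four rounds ahead
-- of Angel: its vertex Z corresponds to the end front Z of the plan before the next letter is appended.
front : V → V
front (t , y , z) = (16 + 4 * t , 4 + y + t , 4 + z + t)

-- The four vertices of the round leading to a vertex of the play. The chosen letter opens the
-- round, so all four lie behind it and depend on the vertex reached alone; they are computed as if
-- that letter had been `0F`.
slices : V → List V
slices (zero  , y , z) = []
slices (suc t , y , z) = walk (front (t , y , z)) (round 0F)

walk-round : ∀ Z c → walk (front Z) (round c) ≡ slices (Z ⊕ unit c)
walk-round (t , y , z) c = subst (λ s → walk (front Z) (round c) ≡ slices s)
  (triple (trans (+-comm 1 t) (cong (t +_) (sym (level-scale 1 c)))) refl refl) (agree c)
  where
  Z = (t , y , z)
  shift : ∀ y t → 4 + y + t + 1 ≡ 4 + (y + 1) + t + 0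
  shift = solve-∀
  keep : ∀ y t → 4 + y + t + 0 ≡ 4 + (y + 0) + t + 0
  keep = solve-∀
  agree : ∀ c → walk (front Z) (round c) ≡ slices (suc t , y + proj₁ (proj₂ (unit c)) , z + proj₂ (proj₂ (unit c)))
  agree 0F = cong (λ v → v ∷ walk v (0F ∷ 1F ∷ 2F ∷ [])) (triple refl (keep y t) (keep z t))
  agree 1F = cong (λ v → v ∷ walk v (0F ∷ 1F ∷ 2F ∷ [])) (triple refl (shift y t) (keep z t))
  agree 2F = cong (λ v → v ∷ walk v (0F ∷ 1F ∷ 2F ∷ [])) (triple refl (keep y t) (shift z t))

front-round : ∀ Z c → front Z ⊕ disp (round c) ≡ front (Z ⊕ unit c)
front-round (t , y , z) = λ
  { 0F → triple (time t) (keep y t) (keep z t)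
  ; 1F → triple (time t) (shift y t) (keep z t)
  ; 2F → triple (time t) (keep y t) (shift z t) }
  where
  time : ∀ t → 16 + 4 * t + 4 ≡ 16 + 4 * (t + 1)
  time = solve-∀
  keep : ∀ y t → 4 + y + t + 1 ≡ 4 + (y + 0) + (t + 1)
  keep = solve-∀
  shift : ∀ y t → 4 + y + t + 2 ≡ 4 + (y + 1) + (t + 1)
  shift = solve-∀

front-injective : ∀ t {y z y′ z′} → front (t , y , z) ≡ front (t , y′ , z′) → y ≡ y′ × z ≡ z′
front-injective t {y} {z} {y′} {z′} eq =
  +-cancelˡ-≡ 4 y y′ (+-cancelʳ-≡ t (4 + y) (4 + y′) (cong (λ v → proj₁ (proj₂ v)) eq)) ,
  +-cancelˡ-≡ 4 z z′ (+-cancelʳ-≡ t (4 + z) (4 + z′) (cong (λ v → proj₂ (proj₂ v)) eq))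

slices-determined : ∀ {v} Z Z′ → v ∈ slices Z → v ∈ slices Z′ → Z ≡ Z′
slices-determined {v} (suc t , y , z) (suc t′ , y′ , z′) p q =
  let i , i<4 , e = ∈-walk (front (t , y , z)) (round 0F) p
      j , j<4 , f = ∈-walk (front (t′ , y′ , z′)) (round 0F) q
      lv : 4 * t + suc i ≡ 4 * t′ + suc j
      lv = +-cancelˡ-≡ 16 _ _ (trans (sym (∈-walk-level (front (t , y , z)) (round 0F) i<4 e)) (∈-walk-level (front (t′ , y′ , z′)) (round 0F) j<4 f))
      t≡ , i≡ = division-unique 4 {t} {t′} i<4 j<4 (suc-injective (trans (sym (+-suc (4 * t) i)) (trans lv (+-suc (4 * t′) j))))
      y≡ , z≡ = front-injective t {y} {z} (⊕-cancelʳ (disp (take (suc i) (round 0F))) (trans (sym e) (trans f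
        (cong₂ (λ s m → front (s , y′ , z′) ⊕ disp (take (suc m) (round 0F))) (sym t≡) (sym i≡)))))
  in triple (cong suc t≡) y≡ z≡

-- The slices of distinct vertices are disjoint, so passing from a round to a move of the play costs
-- no more than adding up Devil's four moves.
slices-bound : ∀ {m} v L → (∀ Z → occ Z L ≤ m) → occ v (concatMap slices L) ≤ m * 1
slices-bound {m} v L bounded = ≤-trans (≤-reflexive (∑-concatMap _ slices L)) (≤-trans
  (∑-unique (λ Z → occ v (slices Z)) L at-most
    (λ {Z} {Z′} p q → slices-determined Z Z′ (0<occ⇒∈ (slices Z) p) (0<occ⇒∈ (slices Z′) q)) bounded)
  (≤-reflexive (sym (*-identityʳ m))))
  where
  at-most : ∀ Z → occ v (slices Z) ≤ 1
  at-most (zero  , y , z) = z≤n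
  at-most (suc t , y , z) = occ-walk≤1 v (front (t , y , z)) (round 0F)

-- Realising the strategy for the group counts by moves in coordinates

module Realisation (n b M K : ℕ) (0<b : 0 < b) (M≡ : M ≡ 6 * b) (K≡ : K ≡ 3576) (default : Fin n) (members : Letter → List (Fin n))
            (length-members : ∀ g → length (members g) ≡ 8 * b)
            (occ-members : ∀ {g i} h → i ∈ members g → Occurrences.occ FinP._≟_ i (members h) ≡ 𝟙 (h FinP.≟ g))
            (Γ : Strategy K) where

  open Weights n M members occ-members
  module Γ = Strategy Γ

  0<M : 0 < M
  0<M = subst (0 <_) (sym M≡) (*-mono-≤ {1} {6} {1} (s≤s z≤n) 0<b)

  one : ℕ → ℚ
  one k = k · 1ℚ

  one-* : ∀ k l → k · one l ≡ one (k * l)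
  one-* k l = ×-assocˡ 1ℚ k l

  one-mono : ∀ {k l} → k ≤ l → one k ℚ.≤ one l
  one-mono = ·-monoˡ (ℚP.≤ᵇ⇒≤ _)

  one-cancel : ∀ k {x l} → 0 < k → k · x ℚ.≤ one (k * l) → x ℚ.≤ one l
  one-cancel k {x} {l} 0<k h = ·-cancel k 0<k (ℚP.≤-trans h (ℚP.≤-reflexive (sym (one-* k l))))

  hit : X → List Letter → Fin n → X → ℕ
  hit x w i v = M ^ length w * 𝟙 (step x i ≟ v) + ψ (step x i) w v

  choose : X → List Letter → Measure X → Fin n
  choose x []      μ = default
  choose x (g ∷ w) μ = argmin (λ i → ∫ (hit x w i) μ) default (members g)

  choose-∈ : ∀ x g w μ → choose x (g ∷ w) μ ∈ members g
  choose-∈ x g w μ = argmin-∈ (λ i → ∫ (hit x w i) μ) default (members g)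
    (subst (0 <_) (sym (length-members g)) (*-mono-≤ {1} {8} {1} (s≤s z≤n) 0<b))

  choose-hit : ∀ {c c′} x g w μ → 3 * c ≤ 4 * c′ → 48 · ∫ (ψ x (g ∷ w)) μ ℚ.≤ one (c * M ^ suc (length w)) →
               48 · ∫ (hit x w (choose x (g ∷ w) μ)) μ ℚ.≤ one (c′ * M ^ length w)
  choose-hit {c} {c′} x g w μ c≤c′ potential = one-cancel 4 {l = c′ * M ^ length w} (s≤s z≤n) (ℚP.≤-trans
    -- The factor `8 * b` is cancelled in two stages, `2 * b` against `6 * b` first and then 4
    -- against the hypothesis on `c` and `c′`.
    (one-cancel (2 * b) {l = 3 * c * M ^ length w} (*-mono-≤ {1} {2} {1} (s≤s z≤n) 0<b) (begin
      (2 * b) · 4 · 48 · H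
        ≡⟨ trans (cong ((2 * b) ·_) (×-assocˡ H 4 48)) (×-assocˡ H (2 * b) (4 * 48)) ⟩
      (2 * b * (4 * 48)) · H
        ≡⟨ trans (cong (_· H) (left b)) (sym (×-assocˡ H 48 (8 * b))) ⟩
      48 · (8 * b) · H
        ≡⟨ cong (λ k → 48 · k · H) (sym (length-members g)) ⟩
      48 · length (members g) · H
        ≤⟨ ·-mono 48 (argmin-average (λ i → ∫ (hit x w i) μ) default (members g)) ⟩
      48 · S (λ i → ∫ (hit x w i) μ) (members g)
        ≡⟨ cong (48 ·_) (trans (sym (∫-∑ (hit x w) (members g) μ)) (∫-cong μ (λ v → sym (ψ-∷ x g w v)))) ⟩
      48 · ∫ (ψ x (g ∷ w)) μ
        ≤⟨ potential ⟩
      one (c * M ^ suc (length w))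
        ≡⟨ cong one (trans (cong (λ M′ → c * (M′ * M ^ length w)) M≡) (right b c (M ^ length w))) ⟩
      one (2 * b * (3 * c * M ^ length w)) ∎))
    (one-mono (≤-trans (*-monoˡ-≤ (M ^ length w) c≤c′) (≤-reflexive (*-assoc 4 c′ (M ^ length w))))))
    where
    open ℚP.≤-Reasoning
    H = ∫ (hit x w (choose x (g ∷ w) μ)) μ
    left : ∀ b → 2 * b * (4 * 48) ≡ 48 * (8 * b)
    left = solve-∀
    right : ∀ b c m → c * (6 * b * m) ≡ 2 * b * (3 * c * m)
    right = solve-∀

  damageAt : X → Measure X → ℚ
  damageAt x = ∫ (λ v → 𝟙 (x ≟ v))

  -- The first summand of `hit` is the damage of the new vertex times `M ^ length w`, so this damage
  -- is at most 45/48.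
  hit-damage : ∀ {c′ x w i μ} → Nonneg μ → c′ ≤ 45 → 48 · ∫ (hit x w i) μ ℚ.≤ one (c′ * M ^ length w) →
               damageAt (step x i) μ ℚ.< 1ℚ
  hit-damage {c′} {x} {w} {i} {μ} μ≥0 c′≤45 h = ℚP.≰⇒> λ 1≤D →
    ℚP.<-irrefl refl (ℚP.<-≤-trans 45<48 (ℚP.≤-trans (·-mono 48 1≤D) 48D≤45))
    where
    D = damageAt (step x i) μ
    m = M ^ length w
    0<m : 0 < m
    0<m = m^n>0 M {{ℕ.>-nonZero 0<M}} (length w)
    45<48 : one 45 ℚ.< one 48
    45<48 = toWitness {a? = one 45 ℚP.<? one 48} _
    48D≤45 : 48 · D ℚ.≤ one 45
    48D≤45 = one-cancel m {l = 45} 0<m (begin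
      m · 48 · D         ≡⟨ trans (×-assocˡ D m 48) (trans (cong (_· D) (*-comm m 48)) (sym (×-assocˡ D 48 m))) ⟩
      48 · m · D         ≡⟨ cong (48 ·_) (sym (∫-* m (λ v → 𝟙 (step x i ≟ v)) μ)) ⟩
      48 · ∫ (λ v → m * 𝟙 (step x i ≟ v)) μ ≤⟨ ·-mono 48 (∫-mono (λ v → m * 𝟙 (step x i ≟ v)) (hit x w i) μ≥0 (λ v → m≤m+n _ _)) ⟩
      48 · ∫ (hit x w i) μ ≤⟨ h ⟩
      one (c′ * m)       ≤⟨ one-mono (≤-trans (*-monoˡ-≤ m c′≤45) (≤-reflexive (*-comm 45 m))) ⟩
      one (m * 45)       ∎)
      where open ℚP.≤-Reasoning

  Few : List Letter → Set
  Few w = ∀ g → count g w ≤ 10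

  -- The group counts of a vertex match at most one point of the plan, and there `orders≤6^` gives
  -- weight at most 1 / M relative to `M ^ suc (length w)`. A mass of `b` then adds at most b / (6
  -- b), which is 8/48.
  ψ-increment : ∀ {x es} g w → Few (g ∷ w) → Nonneg es → mass es ℚ.≤ one b →
                48 · ∫ (ψ x (g ∷ w)) es ℚ.≤ one (8 * M ^ suc (length w))
  ψ-increment {x} {es} g w few es≥0 mass≤ = one-cancel M {l = 8 * M ^ suc (length w)} 0<M (begin
    M · 48 · ∫ (ψ x (g ∷ w)) es
      ≡⟨ trans (×-assocˡ _ M 48) (trans (cong (_· ∫ (ψ x (g ∷ w)) es) (*-comm M 48)) (sym (×-assocˡ _ 48 M))) ⟩
    48 · M · ∫ (ψ x (g ∷ w)) es
      ≡⟨ cong (48 ·_) (sym (∫-* M (ψ x (g ∷ w)) es)) ⟩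
    48 · ∫ (λ v → M * ψ x (g ∷ w) v) es
      ≤⟨ ·-mono 48 (∫-bound (λ v → M * ψ x (g ∷ w) v) es≥0 pointwise) ⟩
    48 · m · mass es
      ≤⟨ ·-mono 48 (·-mono m mass≤) ⟩
    48 · m · one b
      ≡⟨ trans (cong (48 ·_) (one-* m b)) (one-* 48 (m * b)) ⟩
    one (48 * (m * b))
      ≡⟨ cong one (trans (arrange m b) (cong (_* (8 * m)) (sym M≡))) ⟩
    one (M * (8 * m)) ∎)
    where
    open ℚP.≤-Reasoning
    m = M ^ suc (length w)
    arrange : ∀ m b → 48 * (m * b) ≡ 6 * b * (8 * m)
    arrange = solve-∀
    suffix : ∀ h p s → g ∷ w ≡ h ∷ p ++ s → M * (M ^ length s * orders (h ∷ p)) ≤ m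
    suffix h p s refl = *-monoʳ-≤ M (≤-trans (*-monoʳ-≤ (M ^ length s) (≤-trans
          (orders≤6^ (h ∷ p) (λ h′ → ≤-trans (m≤m+n _ (count h′ s)) (≤-trans (≤-reflexive (sym (count-++ h′ (h ∷ p) s))) (few h′))))
          (^-monoˡ-≤ (length p) (≤-trans (*-monoʳ-≤ 6 0<b) (≤-reflexive (sym M≡))))))
        (≤-reflexive (trans (*-comm (M ^ length s) _) (trans (sym (^-distribˡ-+-* M (length p) (length s)))
          (cong (M ^_) (sym (ListP.length-++ p)))))))
    pointwise : ∀ v → M * ψ x (g ∷ w) v ≤ m
    pointwise v = ≤-trans (tailψ-bound M m x [] (g ∷ w) v suffix)
      (≤-trans (*-monoʳ-≤ m (occ-walk≤1 (quot v) (quot x ⊕ disp []) (g ∷ w))) (≤-reflexive (*-identityʳ m)))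

  project : Measure X → V → ℚ
  project μ q = ∫ (λ v → 𝟙 (quot v ≟ⱽ q)) μ

  S-project : ∀ μ L → S (project μ) L ≡ ∫ (λ v → occ (quot v) L) μ
  S-project μ L = sym (∫-∑ (λ q v → 𝟙 (quot v ≟ⱽ q)) L μ)

  Power-project : ∀ {P μ} → Nonneg μ → mass μ ℚ.≤ P → Power P (project μ)
  Power-project {P} {μ} μ≥0 mass≤ = record
    { nonneg = λ q → ∫-nonneg (λ v → 𝟙 (quot v ≟ⱽ q)) μ≥0
    ; bound  = λ L k few → ℚP.≤-trans (ℚP.≤-reflexive (S-project μ L))
        (ℚP.≤-trans (∫-bound (λ v → occ (quot v) L) μ≥0 (λ v → few (quot v))) (·-mono k mass≤)) }

  powers-≥ : ∀ j → b ≤ b ^ suc j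
  powers-≥ j = ≤-trans (≤-reflexive (sym (*-identityʳ b))) (*-monoʳ-≤ b (m^n>0 b {{ℕ.>-nonZero 0<b}} j))

  -- `Within` is the case where `b` is 1. In general the left side gains a factor `b` and the right
  -- side `b ^ suc j`, which is at least as large.
  entry-arithmetic : ∀ {j} w s → Within w → length w ≡ suc j → 192 * K * b * (M ^ s * orders w) ≤ 19 * M ^ (suc j + s)
  entry-arithmetic {j} w s h length≡ = begin
    192 * K * b * (M ^ s * orders w)                ≡⟨ arrange 192 K b (M ^ s) (orders w) ⟩
    orders w * (192 * K) * (b * M ^ s)              ≡⟨ cong (λ K → orders w * (192 * K) * (b * M ^ s)) K≡ ⟩
    orders w * (192 * 3576) * (b * M ^ s)           ≤⟨ *-mono-≤ h (*-monoˡ-≤ (M ^ s) (powers-≥ j)) ⟩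
    6 ^ length w * 19 * (b ^ suc j * M ^ s)         ≡⟨ cong (λ k → 6 ^ k * 19 * (b ^ suc j * M ^ s)) length≡ ⟩
    6 ^ suc j * 19 * (b ^ suc j * M ^ s)            ≡⟨ arrange′ 19 (6 ^ suc j) (b ^ suc j) (M ^ s) ⟩
    19 * (6 ^ suc j * b ^ suc j * M ^ s)            ≡⟨ cong (λ m → 19 * (m * M ^ s)) (trans (sym (^-distribʳ-* (suc j) 6 b)) (cong (_^ suc j) (sym M≡))) ⟩
    19 * (M ^ suc j * M ^ s)                        ≡⟨ cong (19 *_) (sym (^-distribˡ-+-* M (suc j) s)) ⟩
    19 * M ^ (suc j + s)                            ∎
    where
    open ≤-Reasoning
    arrange : ∀ a k b m o → a * k * b * (m * o) ≡ o * (a * k) * (b * m)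
    arrange = solve-∀
    arrange′ : ∀ a x y m → x * a * (y * m) ≡ a * (x * y * m)
    arrange′ = solve-∀
    ^-distribʳ-* : ∀ k x y → (x * y) ^ k ≡ x ^ k * y ^ k
    ^-distribʳ-* zero    x y = refl
    ^-distribʳ-* (suc k) x y = trans (cong (x * y *_) (^-distribʳ-* k x y)) (swap x y (x ^ k) (y ^ k))
      where
      swap : ∀ x y p q → x * y * (p * q) ≡ x * p * (y * q)
      swap = solve-∀

  record RoundState : Set where
    constructor state
    field
      phase : Fin 4
      plan  : List Letter
      γ     : Γ.State
      B     : V → ℚ
      x     : X
      μ     : Measure X

  choice : RoundState → Fin n
  choice (state _ plan _ _ x μ) = choose x plan μ

  newRound : List Letter → Γ.State → X → Measure X → RoundState
  newRound plan γ x μ = state 0F (plan ++ round (Γ.letter γ)) γ (λ _ → 0ℚ) x μ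

  advance : Fin 4 → List Letter → Γ.State → (V → ℚ) → X → Measure X → RoundState
  advance 0F plan γ B x μ = state 1F plan γ B x μ
  advance 1F plan γ B x μ = state 2F plan γ B x μ
  advance 2F plan γ B x μ = state 3F plan γ B x μ
  advance 3F plan γ B x μ = newRound plan (Γ.update γ (collect slices B)) x μ

  move : RoundState → Measure X → RoundState
  move s@(state phase plan γ B x μ) es = advance phase (drop 1 plan) γ (B ⊞ project es) (step x (choice s)) (es ++ μ)

  opening : RoundState
  opening = newRound (rounds (0F ∷ 0F ∷ 0F ∷ 0F ∷ [])) Γ.initial root []

  -- Written in the form in which `Power-collect 1` delivers the four replies of a round.
  power : ℚ
  power = 1 · 4 · one b

  -- In units of 1/48: a move takes c to 3/4 c, and Devil's reply adds 8; the entry of a new round adds at most 19,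
  -- and 60 → 45 + 8 → 40 + 8 → 36 + 8 → 33 + 8 = 60 − 19.
  coefficient : Fin 4 → ℕ
  coefficient 0F = 60
  coefficient 1F = 53
  coefficient 2F = 48
  coefficient 3F = 44

  -- The round for the current letter of the play is already in the plan, so the plan ends at the
  -- front of the target. The number `k` counts Devil's moves in the round, and `c` is the potential
  -- in units of 1/48.
  record Good (γ : Γ.State) (w : List Letter) (k c : ℕ) (B : V → ℚ) (x : X) (μ : Measure X) : Set where
    field
      quot≡   : quot x ⊕ disp w ≡ front (Γ.target γ)
      γ-inv   : Γ.Inv power γ
      B-power : Power (k · one b) B
      γ-dmg   : ∀ z → Γ.dmg γ z ℚ.+ collect slices B z ≡ collect slices (project μ) z
      μ≥0     : Nonneg μ
      ψ≤      : 48 · ∫ (ψ x w) μ ℚ.≤ one (c * M ^ length w)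

  record Invariant (s : RoundState) : Set where
    constructor invariant
    open RoundState s
    field
      c₁ c₂ c₃ c₄ c₅ : Letter
      plan≡ : plan ≡ drop (toℕ phase) (rounds (c₁ ∷ c₂ ∷ c₃ ∷ c₄ ∷ c₅ ∷ []))
      good  : Good γ plan (toℕ phase) (coefficient phase) B x μ

  few-rounds : ∀ c₁ c₂ c₃ c₄ c₅ j g → count g (drop j (rounds (c₁ ∷ c₂ ∷ c₃ ∷ c₄ ∷ c₅ ∷ []))) ≤ 10
  few-rounds c₁ c₂ c₃ c₄ c₅ j g = ≤-trans (≤-trans (m≤n+m _ (count g (take j w)))
    (≤-reflexive (trans (sym (count-++ g (take j w) (drop j w))) (cong (count g) (ListP.take++drop≡id j w))))) (count-rounds g (c₁ ∷ c₂ ∷ c₃ ∷ c₄ ∷ c₅ ∷ []))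
    where w = rounds (c₁ ∷ c₂ ∷ c₃ ∷ c₄ ∷ c₅ ∷ [])

  collect-⊞ : ∀ {D B m a} z → a ℚ.+ collect slices B z ≡ collect slices D z →
              a ℚ.+ collect slices (B ⊞ m) z ≡ collect slices D z ℚ.+ collect slices m z
  collect-⊞ {D} {B} {m} {a} z h = trans (cong (a ℚ.+_) (S.∑-⊕ B m (slices z)))
    (trans (sym (ℚP.+-assoc a _ _)) (cong (ℚ._+ S m (slices z)) h))

  project-++ : ∀ es μ z → collect slices (project (es ++ μ)) z ≡ collect slices (project μ) z ℚ.+ collect slices (project es) z
  project-++ es μ z = trans (S.∑-cong (slices z) (λ q → trans (S.∑-++ _ es μ) (ℚP.+-comm (project es q) (project μ q))))
    (S.∑-⊕ (project μ) (project es) (slices z))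

  Good-step : ∀ {γ g h w k c c′ B x μ es} → 3 * c ≤ 4 * c′ → Few (h ∷ w) → Nonneg es → mass es ℚ.≤ one b →
              Good γ (g ∷ h ∷ w) k c B x μ →
              Good γ (h ∷ w) (suc k) (c′ + 8) (B ⊞ project es) (step x (choose x (g ∷ h ∷ w) μ)) (es ++ μ)
  Good-step {γ} {g} {h} {w} {k} {c} {c′} {B} {x} {μ} {es} c≤c′ few es≥0 mass≤ good = record
    { quot≡   = trans (cong (_⊕ disp (h ∷ w)) (quot-step x (choose-∈ x g (h ∷ w) μ)))
                  (trans (⊕-assoc (quot x) (unit g) (disp (h ∷ w))) quot≡)
    ; γ-inv   = γ-inv
    ; B-power = subst (λ Q → Power Q (B ⊞ project es)) (ℚP.+-comm (k · one b) (one b)) (Power-+ B-power (Power-project es≥0 mass≤))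
    ; γ-dmg   = λ z → trans (collect-⊞ {project μ} {B} {project es} {Γ.dmg γ z} z (γ-dmg z)) (sym (project-++ es μ z))
    ; μ≥0     = AllP.++⁺ es≥0 μ≥0
    ; ψ≤      = potential
    }
    where
    open Good good
    open ℚP.≤-Reasoning
    w′ = h ∷ w
    i  = choose x (g ∷ w′) μ
    x′ = step x i
    potential : 48 · ∫ (ψ x′ w′) (es ++ μ) ℚ.≤ one ((c′ + 8) * M ^ length w′)
    potential = begin
      48 · ∫ (ψ x′ w′) (es ++ μ)
        ≡⟨ trans (cong (48 ·_) (S.∑-++ _ es μ)) (×-distrib-+ (∫ (ψ x′ w′) es) (∫ (ψ x′ w′) μ) 48) ⟩
      48 · ∫ (ψ x′ w′) es ℚ.+ 48 · ∫ (ψ x′ w′) μ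
        ≤⟨ ℚP.+-mono-≤ (ψ-increment h w few es≥0 mass≤)
             (ℚP.≤-trans (·-mono 48 (∫-mono (ψ x′ w′) (hit x w′ i) μ≥0 (λ v → m≤n+m (ψ x′ w′ v) (M ^ length w′ * 𝟙 (step x i ≟ v))))) (choose-hit {c} {c′} x g w′ μ c≤c′ ψ≤)) ⟩
      one (8 * M ^ length w′) ℚ.+ one (c′ * M ^ length w′)
        ≡⟨ sym (×-homo-+ 1ℚ (8 * M ^ length w′) (c′ * M ^ length w′)) ⟩
      one (8 * M ^ length w′ + c′ * M ^ length w′)
        ≡⟨ cong one (trans (+-comm (8 * M ^ length w′) _) (sym (*-distribʳ-+ (M ^ length w′) c′ 8))) ⟩
      one ((c′ + 8) * M ^ length w′) ∎

  entry-bound : ∀ c₁ c₂ c₃ c₄ c g p s → round c ≡ g ∷ p ++ s →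
                192 * K * b * (M ^ length s * orders (rounds (c₁ ∷ c₂ ∷ c₃ ∷ c₄ ∷ []) ++ g ∷ p)) ≤ 19 * M ^ 20
  entry-bound c₁ c₂ c₃ c₄ c g p s eq = subst (λ k → 192 * K * b * (M ^ length s * orders (w ++ g ∷ p)) ≤ 19 * M ^ k)
    (cong (16 +_) (trans (sym (ListP.length-++ (g ∷ p))) (cong length (sym eq))))
    (entry-arithmetic (w ++ g ∷ p) (length s) (prefix p s eq) (ListP.length-++ w {g ∷ p}))
    where
    w = rounds (c₁ ∷ c₂ ∷ c₃ ∷ c₄ ∷ [])
    prefix : ∀ {g} p s → round c ≡ g ∷ p ++ s → Within (w ++ g ∷ p)
    prefix []                  _ refl = entryBound c₁ c₂ c₃ c₄ c 1F
    prefix (_ ∷ [])            _ refl = entryBound c₁ c₂ c₃ c₄ c 2F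
    prefix (_ ∷ _ ∷ [])        _ refl = entryBound c₁ c₂ c₃ c₄ c 3F
    prefix (_ ∷ _ ∷ _ ∷ [])    _ refl = entryBound c₁ c₂ c₃ c₄ c 4F
    prefix (_ ∷ _ ∷ _ ∷ _ ∷ _) _ ()

  -- The new vertices have the group counts listed in the slices of the target, whose damage the
  -- play keeps below `K · power`, that is 4 K b. Together with the unit 1/48 this explains the
  -- factor `192 * K * b`.
  entry : ∀ {γ x μ} c₁ c₂ c₃ c₄ → let w = rounds (c₁ ∷ c₂ ∷ c₃ ∷ c₄ ∷ []) in
          Nonneg μ → quot x ⊕ disp w ≡ front (Γ.pos γ) → Γ.Inv power γ →
          (∀ z → Γ.dmg γ z ≡ collect slices (project μ) z) →
          48 · ∫ (tailψ x w (round (Γ.letter γ))) μ ℚ.≤ one (19 * M ^ 20)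
  entry {γ} {x} {μ} c₁ c₂ c₃ c₄ μ≥0 quot≡ inv dmg≡ = one-cancel (4 * K * b) {l = 19 * M ^ 20} 0<4Kb (begin
    (4 * K * b) · 48 · T
      ≡⟨ trans (×-assocˡ T (4 * K * b) 48) (cong (_· T) (arrange K b)) ⟩
    (192 * K * b) · T
      ≡⟨ sym (∫-* (192 * K * b) (tailψ x w r) μ) ⟩
    ∫ (λ v → 192 * K * b * tailψ x w r v) μ
      ≤⟨ ∫-mono (λ v → 192 * K * b * tailψ x w r v) (λ v → C * occ (quot v) (walk (quot x ⊕ disp w) r)) μ≥0
           (λ v → tailψ-bound (192 * K * b) C x w r v (entry-bound c₁ c₂ c₃ c₄ c)) ⟩
    ∫ (λ v → C * occ (quot v) (walk (quot x ⊕ disp w) r)) μ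
      ≡⟨ ∫-* C (λ v → occ (quot v) (walk (quot x ⊕ disp w) r)) μ ⟩
    C · ∫ (λ v → occ (quot v) (walk (quot x ⊕ disp w) r)) μ
      ≡⟨ cong (C ·_) (sym (S-project μ (walk (quot x ⊕ disp w) r))) ⟩
    C · S (project μ) (walk (quot x ⊕ disp w) r)
      ≡⟨ cong (λ L → C · S (project μ) L) (trans (cong (λ q → walk q r) quot≡) (walk-round (Γ.pos γ) c)) ⟩
    C · collect slices (project μ) (Γ.target γ)
      ≡⟨ cong (C ·_) (sym (dmg≡ (Γ.target γ))) ⟩
    C · Γ.dmg γ (Γ.target γ)
      ≤⟨ ·-mono C (Γ.safe γ inv) ⟩
    C · K · power
      ≡⟨ cong (λ p → C · K · p) (trans (×-homo-1 _) (one-* 4 b)) ⟩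
    C · K · one (4 * b)
      ≡⟨ trans (cong (C ·_) (one-* K (4 * b))) (one-* C (K * (4 * b))) ⟩
    one (C * (K * (4 * b)))
      ≡⟨ cong one (arrange′ C K b) ⟩
    one (4 * K * b * C) ∎)
    where
    open ℚP.≤-Reasoning
    w = rounds (c₁ ∷ c₂ ∷ c₃ ∷ c₄ ∷ [])
    c = Γ.letter γ
    r = round c
    T = ∫ (tailψ x w r) μ
    C = 19 * M ^ 20
    0<4Kb : 0 < 4 * K * b
    0<4Kb = *-mono-≤ {1} {4 * K} {1} (subst (λ K → 1 ≤ 4 * K) (sym K≡) (s≤s z≤n)) 0<b
    arrange : ∀ K b → 4 * K * b * 48 ≡ 192 * K * b
    arrange = solve-∀
    arrange′ : ∀ C K b → C * (K * (4 * b)) ≡ 4 * K * b * C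
    arrange′ = solve-∀

  -- The fourth move of a round leaves 33 + 8 = 41, and the entry of the new round restores 41 + 19
  -- = 60.
  newRound-Invariant : ∀ {γ x μ} c₁ c₂ c₃ c₄ → let w = rounds (c₁ ∷ c₂ ∷ c₃ ∷ c₄ ∷ []) in
                       Nonneg μ → quot x ⊕ disp w ≡ front (Γ.pos γ) → Γ.Inv power γ →
                       (∀ z → Γ.dmg γ z ≡ collect slices (project μ) z) →
                       48 · ∫ (ψ x w) μ ℚ.≤ one (41 * M ^ 16) → Invariant (newRound w γ x μ)
  newRound-Invariant {γ} {x} {μ} c₁ c₂ c₃ c₄ μ≥0 quot≡ inv dmg≡ ψ≤ = invariant c₁ c₂ c₃ c₄ c refl record
    { quot≡   = trans (cong (quot x ⊕_) (disp-++ w r)) (trans (sym (⊕-assoc (quot x) (disp w) (disp r)))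
                  (trans (cong (_⊕ disp r) quot≡) (front-round (Γ.pos γ) c)))
    ; γ-inv   = inv
    ; B-power = Power-0
    ; γ-dmg   = λ z → trans (cong (Γ.dmg γ z ℚ.+_) (S-zero (slices z))) (trans (ℚP.+-identityʳ _) (dmg≡ z))
    ; μ≥0     = μ≥0
    ; ψ≤      = begin
        48 · ∫ (ψ x (w ++ r)) μ
          ≡⟨ cong (48 ·_) (trans (∫-cong μ (tailψ-++ x [] w r)) (trans (∫-+ (λ v → M ^ 4 * ψ x w v) (tailψ x w r) μ)
               (cong (ℚ._+ ∫ (tailψ x w r) μ) (∫-* (M ^ 4) (ψ x w) μ)))) ⟩
        48 · ((M ^ 4) · ∫ (ψ x w) μ ℚ.+ ∫ (tailψ x w r) μ)
          ≡⟨ trans (×-distrib-+ ((M ^ 4) · ∫ (ψ x w) μ) (∫ (tailψ x w r) μ) 48)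
               (cong (ℚ._+ 48 · ∫ (tailψ x w r) μ) (exchange (∫ (ψ x w) μ))) ⟩
        (M ^ 4) · 48 · ∫ (ψ x w) μ ℚ.+ 48 · ∫ (tailψ x w r) μ
          ≤⟨ ℚP.+-mono-≤ (·-mono (M ^ 4) ψ≤) (entry c₁ c₂ c₃ c₄ μ≥0 quot≡ inv dmg≡) ⟩
        (M ^ 4) · one (41 * M ^ 16) ℚ.+ one (19 * M ^ 20)
          ≡⟨ trans (cong (ℚ._+ one (19 * M ^ 20)) (one-* (M ^ 4) (41 * M ^ 16))) (sym (×-homo-+ 1ℚ (M ^ 4 * (41 * M ^ 16)) (19 * M ^ 20))) ⟩
        one (M ^ 4 * (41 * M ^ 16) + 19 * M ^ 20)
          ≡⟨ cong one powers ⟩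
        one (60 * M ^ 20) ∎
    }
    where
    open ℚP.≤-Reasoning
    w = rounds (c₁ ∷ c₂ ∷ c₃ ∷ c₄ ∷ [])
    c = Γ.letter γ
    r = round c
    exchange : ∀ y → 48 · (M ^ 4) · y ≡ (M ^ 4) · 48 · y
    exchange y = trans (×-assocˡ y 48 (M ^ 4)) (trans (cong (_· y) (*-comm 48 (M ^ 4))) (sym (×-assocˡ y (M ^ 4) 48)))
    powers : M ^ 4 * (41 * M ^ 16) + 19 * M ^ 20 ≡ 60 * M ^ 20
    powers = trans (cong (λ m → M ^ 4 * (41 * M ^ 16) + 19 * m) (^-distribˡ-+-* M 4 16))
      (trans (sum (M ^ 4) (M ^ 16)) (cong (60 *_) (sym (^-distribˡ-+-* M 4 16))))
      where
      sum : ∀ p q → p * (41 * q) + 19 * (p * q) ≡ 60 * (p * q)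
      sum = solve-∀

  quot-root : quot root ≡ (0 , 0 , 0)
  quot-root = triple (cong₂ _+_ (cong₂ _+_ (zeros 0F) (zeros 1F)) (zeros 2F)) (zeros 1F) (zeros 2F)
    where
    zeros : ∀ g → sumOver g root ≡ 0
    zeros g = trans (∑-cong (members g) (λ i → VecP.lookup-replicate i 0)) (∑-ε (members g))

  opening-Invariant : Invariant opening
  opening-Invariant = newRound-Invariant 0F 0F 0F 0F []
    -- Four opening rounds with letter `0F` make 16 moves, four of them in each of the other two
    -- groups; this is the front of the origin.
    (trans (cong (_⊕ (16 , 4 , 4)) quot-root) (cong front (sym Γ.pos-initial)))
    (Γ.Inv-initial (·-nonneg 1 (·-nonneg 4 (one-mono {0} {b} z≤n))))
    (λ z → trans (Γ.dmg-initial z) (sym (S-zero (slices z))))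
    -- Nothing is damaged yet, so the vertices of the opening rounds enter the plan with potential
    -- 0.
    (one-mono {0} {41 * M ^ 16} z≤n)

  move-Invariant : ∀ s es → Nonneg es → mass es ℚ.≤ one b → Invariant s → Invariant (move s es)
  move-Invariant (state 0F _ γ B x μ) es es≥0 mass≤ (invariant c₁ c₂ c₃ c₄ c₅ refl good) =
    invariant c₁ c₂ c₃ c₄ c₅ refl (Good-step {c = 60} {45} (ℕP.≤ᵇ⇒≤ 180 180 _) (few-rounds c₁ c₂ c₃ c₄ c₅ 1) es≥0 mass≤ good)
  move-Invariant (state 1F _ γ B x μ) es es≥0 mass≤ (invariant c₁ c₂ c₃ c₄ c₅ refl good) =
    invariant c₁ c₂ c₃ c₄ c₅ refl (Good-step {c = 53} {40} (ℕP.≤ᵇ⇒≤ 159 160 _) (few-rounds c₁ c₂ c₃ c₄ c₅ 2) es≥0 mass≤ good)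
  move-Invariant (state 2F _ γ B x μ) es es≥0 mass≤ (invariant c₁ c₂ c₃ c₄ c₅ refl good) =
    invariant c₁ c₂ c₃ c₄ c₅ refl (Good-step {c = 48} {36} (ℕP.≤ᵇ⇒≤ 144 144 _) (few-rounds c₁ c₂ c₃ c₄ c₅ 3) es≥0 mass≤ good)
  move-Invariant (state 3F _ γ B x μ) es es≥0 mass≤ (invariant c₁ c₂ c₃ c₄ c₅ refl good) =
    newRound-Invariant c₂ c₃ c₄ c₅ (Good.μ≥0 after)
      (trans (Good.quot≡ after) (cong front (sym (Γ.pos-update γ (collect slices (B ⊞ project es))))))
      (Γ.update-Inv γ (Good.γ-inv after) (Power-collect 1 (λ v L → slices-bound v L) (Good.B-power after)))
      (λ z → trans (Γ.dmg-update γ (collect slices (B ⊞ project es)) z) (Good.γ-dmg after z))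
      (Good.ψ≤ after)
    where
    after = Good-step {c = 44} {33} (ℕP.≤ᵇ⇒≤ 132 132 _) (few-rounds c₁ c₂ c₃ c₄ c₅ 4) es≥0 mass≤ good

  Good-safe : ∀ {γ g w k c c′ B x μ} → 3 * c ≤ 4 * c′ → c′ ≤ 45 → Good γ (g ∷ w) k c B x μ →
              damageAt (step x (choose x (g ∷ w) μ)) μ ℚ.< 1ℚ
  Good-safe {g = g} {w} {c = c} {c′} {x = x} {μ} c≤c′ c′≤45 good =
    hit-damage {c′} {x} {w} {choose x (g ∷ w) μ} {μ} (Good.μ≥0 good) c′≤45 (choose-hit {c} {c′} x g w μ c≤c′ (Good.ψ≤ good))

  choice-safe : ∀ s → Invariant s → damageAt (step (RoundState.x s) (choice s)) (RoundState.μ s) ℚ.< 1ℚ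
  choice-safe (state 0F _ γ B x μ) (invariant c₁ c₂ c₃ c₄ c₅ refl good) = Good-safe {c = 60} {45} (ℕP.≤ᵇ⇒≤ 180 180 _) (ℕP.≤ᵇ⇒≤ 45 45 _) good
  choice-safe (state 1F _ γ B x μ) (invariant c₁ c₂ c₃ c₄ c₅ refl good) = Good-safe {c = 53} {40} (ℕP.≤ᵇ⇒≤ 159 160 _) (ℕP.≤ᵇ⇒≤ 40 45 _) good
  choice-safe (state 2F _ γ B x μ) (invariant c₁ c₂ c₃ c₄ c₅ refl good) = Good-safe {c = 48} {36} (ℕP.≤ᵇ⇒≤ 144 144 _) (ℕP.≤ᵇ⇒≤ 36 45 _) good
  choice-safe (state 3F _ γ B x μ) (invariant c₁ c₂ c₃ c₄ c₅ refl good) = Good-safe {c = 44} {33} (ℕP.≤ᵇ⇒≤ 132 132 _) (ℕP.≤ᵇ⇒≤ 33 45 _) good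

-- The games of the statement

-- The division in `ℕtoℚ` normalises by a gcd that does not reduce for a variable, so the induction
-- step is carried out in the unnormalised rationals.
ℕtoℚ-· : ∀ k → ℕtoℚ k ≡ k · 1ℚ
ℕtoℚ-· zero    = refl
ℕtoℚ-· (suc k) = trans (ℚP.toℚᵘ-injective (begin
  ℚ.toℚᵘ (ℕtoℚ (suc k))                 ≈⟨ ℚP.toℚᵘ-fromℚᵘ (ℚᵘ.mkℚᵘ (ℤ.+ suc k) 0) ⟩
  ℚᵘ.mkℚᵘ (ℤ.+ suc k) 0                   ≈⟨ ℚᵘ.*≡* (cong (λ i → i ℤ.* ℤ.+ 1) (sym (cong (ℤ._+_ (ℤ.+ 1)) (ℤP.*-identityʳ (ℤ.+ k))))) ⟩
  ℚᵘ.1ℚᵘ ℚᵘ.+ ℚᵘ.mkℚᵘ (ℤ.+ k) 0           ≈⟨ ℚᵘP.+-congʳ ℚᵘ.1ℚᵘ (ℚᵘP.≃-sym (ℚP.toℚᵘ-fromℚᵘ (ℚᵘ.mkℚᵘ (ℤ.+ k) 0))) ⟩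
  ℚᵘ.1ℚᵘ ℚᵘ.+ ℚ.toℚᵘ (ℕtoℚ k)           ≈⟨ ℚᵘP.≃-sym (ℚP.toℚᵘ-homo-+ 1ℚ (ℕtoℚ k)) ⟩
  ℚ.toℚᵘ (1ℚ ℚ.+ ℕtoℚ k)                ∎)) (cong (1ℚ ℚ.+_) (ℕtoℚ-· k))
  where open ℚᵘP.≃-Reasoning

-- The definition is inferred from its use in the lemma: it names the function local to moveDamage.
mutual
  go : ∀ {n p} → FracMove n p → Vertex n → List (Vertex n × ℚ) → ℚ
  go = _

  moveDamage-go : ∀ {n p} (m : FracMove n p) v → moveDamage m v ≡ go m v (FracMove.increments m)
  moveDamage-go m v with FracMove.increments m
  ... | es = refl

moveDamage-∫ : ∀ {n p} (m : FracMove n p) v → moveDamage m v ≡ ∫ (λ w → 𝟙 (VecP.≡-dec ℕ._≟_ v w)) (FracMove.increments m)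
moveDamage-∫ {n} m v = trans (moveDamage-go m v) (go-∫ (FracMove.increments m))
  where
  go-∫ : ∀ es → go m v es ≡ ∫ (λ w → 𝟙 (VecP.≡-dec ℕ._≟_ v w)) es
  go-∫ []             = refl
  go-∫ ((w , a) ∷ es) with VecP.≡-dec ℕ._≟_ w v | VecP.≡-dec ℕ._≟_ v w
  ... | yes _   | yes _   = cong₂ ℚ._+_ (sym (ℚP.+-identityʳ a)) (go-∫ es)
  ... | no _    | no _    = trans (go-∫ es) (sym (ℚP.+-identityˡ _))
  ... | yes w≡v | no v≢w  = ⊥-elim (v≢w (sym w≡v))
  ... | no w≢v  | yes v≡w = ⊥-elim (w≢v (sym v≡w))

sumℚ-map : {A : Set} (f : A → ℚ) (xs : List A) → sumℚ (map f xs) ≡ S f xs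
sumℚ-map f []       = refl
sumℚ-map f (x ∷ xs) = cong (f x ℚ.+_) (sumℚ-map f xs)

-- Strategies from state machines and their transfer between games

module Machine {n : ℕ} {M State : Set} (first : State) (choice : State → Fin n) (move : State → M → State) (pos : State → Vertex n)
               (pos-first : pos first ≡ root) (pos-move : ∀ s m → pos (move s m) ≡ step (pos s) (choice s)) where

  states : List M → State
  states []       = first
  states (m ∷ ms) = move (states ms) m

  σ : AngelStrategy n M
  σ ms = choice (states ms)

  module _ (τ : DevilStrategy n M) where

    -- Devil's moves alone determine Angel's position, so the state computed from them agrees with
    -- the head of the list of positions.
    position : ∀ k → ∃ λ ps → play σ τ k ≡ (pos (states (devilHistory σ τ k)) ∷ ps , devilHistory σ τ k)
    position zero    = [] , cong (λ x → x ∷ [] , []) (sym pos-first)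
    position (suc k) with play σ τ k | position k
    ... | x ∷ ps , ms | _ , refl = x ∷ ps , cong (λ y → y ∷ x ∷ ps , τ (step x (σ ms) ∷ x ∷ ps) ∷ ms) (sym (pos-move (states ms) _))

    angelTarget-σ : ∀ k → angelTarget σ τ k ≡ step (pos (states (devilHistory σ τ k))) (σ (devilHistory σ τ k))
    angelTarget-σ k with play σ τ k | position k
    ... | _ ∷ _ , ms | _ , refl = refl

module Translation {n : ℕ} {M M′ : Set} (f : M → M′) (σ : AngelStrategy n M′) (τ : DevilStrategy n M) where

  σ′ : AngelStrategy n M
  σ′ ms = σ (map f ms)

  plays : ∀ k → play σ (f ∘ τ) k ≡ (proj₁ (play σ′ τ k) , map f (proj₂ (play σ′ τ k)))
  plays zero    = refl
  plays (suc k) rewrite plays k with play σ′ τ k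
  ... | [] , _    = refl
  ... | _ ∷ _ , _ = refl

  history : ∀ k → devilHistory σ (f ∘ τ) k ≡ map f (devilHistory σ′ τ k)
  history k = cong proj₂ (plays k)

  target : ∀ k → angelTarget σ (f ∘ τ) k ≡ angelTarget σ′ τ k
  target k rewrite plays k with play σ′ τ k
  ... | [] , _    = refl
  ... | _ ∷ _ , _ = refl

module Fractional (b : ℕ) (0<b : 0 < b) where

  open Groups 8 b

  open Realisation (24 * b) b (6 * b) 3576 0<b refl refl (index 0F (0F , Fin.fromℕ< 0<b)) members length-members occ-members strategy
  open Weights (24 * b) (6 * b) members occ-members using (_≟_)

  Devil : Set
  Devil = FracMove (24 * b) (ℕtoℚ b)

  move-fields : ∀ s es → RoundState.x (move s es) ≡ step (RoundState.x s) (choice s) × RoundState.μ (move s es) ≡ es ++ RoundState.μ s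
  move-fields (state 0F _ _ _ _ _) es = refl , refl
  move-fields (state 1F _ _ _ _ _) es = refl , refl
  move-fields (state 2F _ _ _ _ _) es = refl , refl
  move-fields (state 3F _ _ _ _ _) es = refl , refl

  open Machine opening choice (λ s (m : Devil) → move s (FracMove.increments m)) RoundState.x refl
    (λ s m → proj₁ (move-fields s (FracMove.increments m))) public

  states-Invariant : ∀ ms → Invariant (states ms)
  states-Invariant []       = opening-Invariant
  states-Invariant (m ∷ ms) = move-Invariant (states ms) increments nonneg
    (ℚP.≤-trans (ℚP.≤-reflexive (sym (sumℚ-map proj₂ increments))) (ℚP.≤-trans budget (ℚP.≤-reflexive (ℕtoℚ-· b)))) (states-Invariant ms)
    where open FracMove m

  damage-states : ∀ ms v → damage ms v ≡ damageAt v (RoundState.μ (states ms))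
  damage-states []       v = refl
  damage-states (m ∷ ms) v = trans (cong₂ ℚ._+_ (moveDamage-∫ m v) (damage-states ms v))
    (trans (sym (S.∑-++ _ (FracMove.increments m) _)) (cong (damageAt v) (sym (proj₂ (move-fields (states ms) (FracMove.increments m))))))

  survives : (τ : DevilStrategy (24 * b) Devil) → ∀ k → damage (devilHistory σ τ k) (angelTarget σ τ k) ℚ.< 1ℚ
  survives τ k = subst (ℚ._< 1ℚ)
    (trans (sym (damage-states ms _)) (cong (damage ms) (sym (angelTarget-σ τ k))))
    (choice-safe (states ms) (states-Invariant ms))
    where ms = devilHistory σ τ k

fractional : ∀ b → b > 0 → AngelWinsFrac (24 * b) (ℕtoℚ b)
fractional b 0<b = σ , survives
  where open Fractional b 0<b

module Biased (n b : ℕ) where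

  burn : BurnMove n b → FracMove n (ℕtoℚ b)
  burn (burnMove vs bound) = fracMove (map (_, 1ℚ) vs) (AllP.map⁺ (All.universal (λ _ → ℚP.≤ᵇ⇒≤ _) vs)) (begin
    sumℚ (map proj₂ (map (_, 1ℚ) vs)) ≡⟨ total vs ⟩
    length vs · 1ℚ                    ≤⟨ ·-monoˡ (ℚP.≤ᵇ⇒≤ _) bound ⟩
    b · 1ℚ                            ≡⟨ sym (ℕtoℚ-· b) ⟩
    ℕtoℚ b                            ∎)
    where
    open ℚP.≤-Reasoning
    total : ∀ vs → sumℚ (map proj₂ (map (_, 1ℚ) vs)) ≡ length vs · 1ℚ
    total []       = refl
    total (v ∷ vs) = cong (1ℚ ℚ.+_) (total vs)

  moveDamage-nonneg : ∀ m v → 0ℚ ℚ.≤ moveDamage (burn m) v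
  moveDamage-nonneg m v = subst (0ℚ ℚ.≤_) (sym (moveDamage-∫ (burn m) v))
    (∫-nonneg (λ w → 𝟙 (VecP.≡-dec ℕ._≟_ v w)) (FracMove.nonneg (burn m)))

  -- A burn counts as damage 1, and later moves never lower the damage. A vertex burned repeatedly
  -- only exceeds 1 further.
  burned⇒damaged : ∀ ms {v} → v ∈ burnedSoFar ms → 1ℚ ℚ.≤ damage (map burn ms) v
  burned⇒damaged (m ∷ ms) {v} v∈ with ∈-++⁻ (BurnMove.burned m) v∈
  ... | inj₂ v∈ms = ℚP.≤-trans (burned⇒damaged ms v∈ms) (y≤x+y (moveDamage-nonneg m v))
  ... | inj₁ v∈m  = ℚP.≤-trans (subst (1ℚ ℚ.≤_) (sym (moveDamage-∫ (burn m) v)) (hit v∈m)) (x≤x+y (damage-nonneg ms))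
    where
    damage-nonneg : ∀ ms → 0ℚ ℚ.≤ damage (map burn ms) v
    damage-nonneg []       = ℚP.≤-refl
    damage-nonneg (m ∷ ms) = ℚP.+-mono-≤ (moveDamage-nonneg m v) (damage-nonneg ms)
    hit : ∀ {vs} → v ∈ vs → 1ℚ ℚ.≤ ∫ (λ w → 𝟙 (VecP.≡-dec ℕ._≟_ v w)) (map (_, 1ℚ) vs)
    hit {w ∷ vs} (here refl) = ℚP.≤-trans (ℚP.≤-reflexive (sym (trans (cong (_· 1ℚ) (𝟙-yes (VecP.≡-dec ℕ._≟_ v v) refl)) (×-homo-1 1ℚ))))
      (x≤x+y (∫-nonneg (λ w → 𝟙 (VecP.≡-dec ℕ._≟_ v w)) (AllP.map⁺ (All.universal (λ _ → ℚP.≤ᵇ⇒≤ _) vs))))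
    hit {w ∷ vs} (there v∈) = ℚP.≤-trans (hit v∈) (y≤x+y (·-nonneg (𝟙 (VecP.≡-dec ℕ._≟_ v w)) (ℚP.≤ᵇ⇒≤ _)))

  biased : AngelWinsFrac n (ℕtoℚ b) → AngelWinsBiased n b
  biased (σ , wins) = (λ ms → σ (map burn ms)) , λ τ k burned → ℚP.<-irrefl refl (ℚP.<-≤-trans
    (subst (ℚ._< 1ℚ) (cong₂ damage (Translation.history burn σ τ k) (Translation.target burn σ τ k)) (wins (burn ∘ τ) k))
    (burned⇒damaged (devilHistory (λ ms → σ (map burn ms)) τ k) burned))

theorem16 : (b : ℕ) → b > 0 →
    AngelWinsFrac (24 * b) (ℕtoℚ b) × AngelWinsBiased (24 * b) b
theorem16 b b>0 = fractional b b>0 , Biased.biased (24 * b) b (fractional b b>0)
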